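{- Let $\tau = \frac{4-\sqrt{7}}{9}$, so that $\frac{1+\tau^2}{4} = \frac{26-2\sqrt{7}}{81}$. Let $G_1, G_2, G_3$ be graphs on a common set $V$ of $n$ vertices. If $|E(G_i)| > \frac{1+\tau^2}{4} n^2$ for every $1 \le i \le 3$, then there exists a rainbow triangle, i.e. there exist distinct vertices $v_1, v_2, v_3 \in V$ such that $v_1v_2 \in E(G_1)$, $v_2v_3 \in E(G_2)$ and $v_3v_1 \in E(G_3)$.
   Context: All graphs are finite and simple (undirected, no loops, no multiple edges). The graphs $G_1, G_2, G_3$ share the same vertex set; their edge sets may overlap arbitrarily. -}

module Defs where

open import Data.Nat.Base as ℕ using (ℕ)
open import Data.Integer.Base using (+_)
open import Data.Rational.Base as ℚ using (ℚ; 0ℚ; 1ℚ)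
open import Data.Fin.Base using (Fin)
open import Data.Fin.Properties using (_<?_)
open import Data.List.Base using (List; filter; length; cartesianProduct; allFin)
open import Data.Product.Base using (_×_; _,_)
open import Data.Sum.Base using (_⊎_)
open import Relation.Nullary.Decidable using (_×-dec_)
open import Relation.Binary.Core using (Rel)
open import Relation.Binary.Definitions using (Symmetric; Irreflexive; Decidable)
open import Relation.Binary.PropositionalEquality using (_≡_)
open import Level using (0ℓ)

infixl 7 _*_ _÷_
infixl 6 _+_ _-_
infix  5 _+√7·_
infix  4 _<_ _>_

-- The real subfield ℚ(√7): every real constant below lies in it. Since √7 is
-- irrational, a + b√7 determines a and b, so _≡_ is equality of real numbers.
record ℚ[√7] : Set where
  constructor _+√7·_
  field
    rat irr : ℚ

fromℚ : ℚ → ℚ[√7]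
fromℚ p = p +√7· 0ℚ

fromℕ : ℕ → ℚ[√7]
fromℕ k = fromℚ (+ k ℚ./ 1)

√7 : ℚ[√7]
√7 = 0ℚ +√7· 1ℚ

_+_ : ℚ[√7] → ℚ[√7] → ℚ[√7]
(a +√7· b) + (c +√7· d) = (a ℚ.+ c) +√7· (b ℚ.+ d)

_-_ : ℚ[√7] → ℚ[√7] → ℚ[√7]
(a +√7· b) - (c +√7· d) = (a ℚ.- c) +√7· (b ℚ.- d)

_*_ : ℚ[√7] → ℚ[√7] → ℚ[√7]
(a +√7· b) * (c +√7· d) =
  (a ℚ.* c ℚ.+ (+ 7 ℚ./ 1) ℚ.* (b ℚ.* d)) +√7· (a ℚ.* d ℚ.+ b ℚ.* c)

_÷_ : ℚ[√7] → (k : ℕ) → .{{ℕ.NonZero k}} → ℚ[√7]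
x ÷ k = x * fromℚ (+ 1 ℚ./ k)

-- The order inherited from the reals (with √7 > 0). Unless a = b = 0 we have
-- a² ≠ 7b², and the sign of a + b√7 is the sign of a if a² > 7b², and the sign
-- of b if 7b² > a².
Positive : ℚ[√7] → Set
Positive (a +√7· b) =
    (0ℚ ℚ.< a × (+ 7 ℚ./ 1) ℚ.* (b ℚ.* b) ℚ.< a ℚ.* a)
  ⊎ (0ℚ ℚ.< b × a ℚ.* a ℚ.< (+ 7 ℚ./ 1) ℚ.* (b ℚ.* b))

_<_ : ℚ[√7] → ℚ[√7] → Set
x < y = Positive (y - x)

_>_ : ℚ[√7] → ℚ[√7] → Set
x > y = y < x

τ : ℚ[√7]
τ = (fromℕ 4 - √7) ÷ 9

-- Decidability of adjacency lets edges be counted; classically it is no restriction.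
record Graph (n : ℕ) : Set₁ where
  field
    Adj    : Rel (Fin n) 0ℓ
    adj?   : Decidable Adj
    sym    : Symmetric Adj
    irrefl : Irreflexive _≡_ Adj

open Graph public using (Adj)

-- Each undirected edge is listed once, as the pair (u , v) with u < v.
edges : ∀ {n} → Graph n → List (Fin n × Fin n)
edges {n} G =
  filter (λ (u , v) → (u <? v) ×-dec Graph.adj? G u v)
         (cartesianProduct (allFin n) (allFin n))

∣E_∣ : ∀ {n} → Graph n → ℕ
∣E G ∣ = length (edges G)

{-# OPTIONS --safe #-}
module Submission where

-- Suppose there is no rainbow triangle. For a multiset of N vertices let d_k be the
-- number of ordered pairs joined in G_k divided by N², let P = d₁ + d₂ + d₃ − 1 and
-- Q_k = P − d_k, so that 2P = 1 + ΣQ_k. On V itself Q_k ≥ y for a rational y with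
-- θ² < y, where θ = (9y + 1)/8; since 9τ² − 8τ + 1 = 0, this is what d_k > (1 + τ²)/2 means.
-- Take a multiset, large enough, that is a local maximum of P − C Σ ((T − Q_k)⁺)² with
-- θ² < T < y and C large. There Q_k ≥ θ² and 2P ≥ 1 + 3y, so some Q_p ≥ T is not penalised,
-- and with h, h_k the gradients of P, Q_k the Lagrangian h + Σ μ_k h_k is almost the same
-- number Λ = P + Σ μ_k Q_k at all vertices. No pair carries all three colours, and if uv
-- carries the two colours other than k, then 2Λ ≤ (1 + μ_k)(h(u) + h(v)). Finally one
-- can choose a pair of each of the three kinds so that the six values of h add up to at
-- most 2. Hence Λ (1 + 1/(1 + μ_q) + 1/(1 + μ_r)) ≤ 1, while
-- Λ > (1 − 2θ)² + θ² (1 + μ_q) + θ² (1 + μ_r), against the Cauchy–Schwarz inequality.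

open import Data.Bool.Base using (Bool; true; false; not; T)
open import Data.Bool.Properties using (T?)
open import Data.Empty using (⊥; ⊥-elim)
open import Data.Fin.Base as Fin using (Fin; zero; suc; _↑ˡ_; _↑ʳ_; remainder)
open import Data.Fin.Patterns using (0F; 1F; 2F)
open import Data.Fin.Properties as Fin using (_≟_; all?; any?; ¬∀⟶∃¬)
open import Data.List.Base as List using (length; filter; cartesianProduct; _++_)
import Data.List.Properties as List
open import Data.Nat.Base as ℕ using (ℕ; zero; suc; z≤n)
open import Data.Nat.Induction using (<-wellFounded)
open import Data.Product using (_×_; _,_; proj₁; proj₂; ∃-syntax)
open import Data.Sum.Base using (_⊎_; inj₁; inj₂; [_,_]′)
open import Data.Vec.Functional using (Vector; updateAt)
open import Function.Base using (_∘_; const; id)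
open import Function.Bundles using (mk⇔)
open import Induction.WellFounded using (Acc; acc)
open import Level using (0ℓ)
open import Relation.Binary.Definitions using (tri<; tri≈; tri>)
open import Relation.Binary.PropositionalEquality
open import Relation.Nullary using (¬_; Dec; yes; no; does; contradiction)
open import Relation.Nullary.Decidable
  using (map′; from-yes; _→-dec_; _×-dec_; _⊎-dec_; ¬?; does-⇔; dec-true; dec-false)
open import Relation.Unary using (Pred; Decidable)

-- The value of θ is forced by the last step. From Q_k ≥ y comes 2P ≥ 1 + 3y, and P has to beat (1 -
-- 2θ)² + 2θ². Choosing 8θ = 9y + 1 makes the surplus (1 + 3y)/2 - (1 - 2θ)² - 2θ² equal to 6(y -
-- θ²), so there is a gain exactly when θ² < y, and the break-even point y = θ² is the equation 9τ²
-- - 8τ + 1 = 0. A maximum over real vertex weights under the constraints Q_k ≥ y would call for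
-- compactness and Lagrange multipliers. A multiset with a penalty replaces both: the potential is
-- an integer, so ascent terminates, and the multipliers μ_k are read off from the penalty. The
-- price is that constraints and stationarity hold only up to errors, which the gap y - θ² absorbs.
-- To stay in ℤ, with θ = Θ/W and N = 2Ws, densities are multiplied by N² = 4W²s² and the potential
-- by a further s².

module Integers where

  open import Data.Integer.Base hiding (suc; pred)
  open import Data.Integer.Properties hiding (_≟_)
  open import Data.Integer.Tactic.RingSolver using (solve-∀)
  open import Algebra.Properties.Semiring.Sum +-*-semiring
    using (sum)

  -- Integer inequalities from nonnegative combinations.

  0≤+ : ∀ {a b} → 0ℤ ≤ a → 0ℤ ≤ b → 0ℤ ≤ a + b
  0≤+ p q = +-mono-≤ p q

  0≤* : ∀ {a b} → 0ℤ ≤ a → 0ℤ ≤ b → 0ℤ ≤ a * b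
  0≤* {+ a} {+ b} p q = subst (0ℤ ≤_) (pos-* a b) (+≤+ ℕ.z≤n)

  0≤² : ∀ a → 0ℤ ≤ a * a
  0≤² (+ a)     = 0≤* {+ a} {+ a} (+≤+ ℕ.z≤n) (+≤+ ℕ.z≤n)
  0≤² -[1+ a ]  = +≤+ ℕ.z≤n

  0≤+n : ∀ {n} → 0ℤ ≤ + n
  0≤+n = +≤+ ℕ.z≤n

  gap : ∀ {a b} → a ≤ b → 0ℤ ≤ b - a
  gap = i≤j⇒0≤j-i

  gap-< : ∀ {a b} → a < b → 0ℤ ≤ b - a - 1ℤ
  gap-< {a} {b} a<b = subst (0ℤ ≤_) (lemma a b) (gap (i<j⇒suc[i]≤j a<b))
    where
    lemma : ∀ a b → b - (1ℤ + a) ≡ b - a - 1ℤ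
    lemma = solve-∀

  ≤-by : ∀ {a b c} → 0ℤ ≤ c → c ≡ b - a → a ≤ b
  ≤-by p refl = 0≤i-j⇒j≤i p

  sum-mono : ∀ {n} {f g : Vector ℤ n} → (∀ i → f i ≤ g i) → sum f ≤ sum g
  sum-mono {zero}  f≤g = ≤-refl
  sum-mono {suc n} f≤g = +-mono-≤ (f≤g zero) (sum-mono (f≤g ∘ suc))

  sum-const : ∀ n c → sum {n} (const c) ≡ + n * c
  sum-const zero    c = sym (*-zeroˡ c)
  sum-const (suc n) c = begin
    c + sum {n} (const c) ≡⟨ cong (_+_ c) (sum-const n c) ⟩
    c + + n * c           ≡⟨ suc-* (+ n) c ⟨
    + suc n * c           ∎
    where open ≡-Reasoning

  ∑-distrib-- : ∀ {n} (f g : Vector ℤ n) → sum (λ i → f i - g i) ≡ sum f - sum g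
  ∑-distrib-- {zero}  f g = refl
  ∑-distrib-- {suc n} f g = trans (cong (_+_ (f zero - g zero)) (∑-distrib-- (f ∘ suc) (g ∘ suc)))
                                  (lemma (f zero) (g zero) (sum (f ∘ suc)) (sum (g ∘ suc)))
    where
    lemma : ∀ a b c d → a - b + (c - d) ≡ a + c - (b + d)
    lemma = solve-∀

  sum>0⇒∃>0 : ∀ {n} (f : Vector ℤ n) → 0ℤ < sum f → ∃[ i ] 0ℤ < f i
  sum>0⇒∃>0 {n} f 0<∑ with any? (λ i → 0ℤ <? f i)
  ... | yes p = p
  ... | no ¬p = contradiction
    (<-≤-trans 0<∑ (≤-trans (sum-mono (λ i → ≮⇒≥ (λ q → ¬p (i , q)))) (≤-reflexive (trans (sum-const n 0ℤ) (*-zeroʳ (+ n))))))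
    (<-irrefl refl)

  -- Pattern of most contradictions below: the hypotheses, written as nonnegative gaps, are
  -- multiplied by nonnegative factors and added, and the ring solver identifies the total with a
  -- negative constant. `≤-by` does the same for a direct inequality.
  neg-absurd : ∀ {A : Set} {c n} → 0ℤ ≤ c → c ≡ -[1+ n ] → A
  neg-absurd () refl

  0≤≥1 : ∀ {a} → 1ℤ ≤ a → 0ℤ ≤ a
  0≤≥1 = ≤-trans (+≤+ ℕ.z≤n)

  1≤* : ∀ {a b} → 1ℤ ≤ a → 1ℤ ≤ b → 1ℤ ≤ a * b
  1≤* {a} {b} p q = ≤-by (0≤+ (0≤* (gap p) (gap q)) (0≤+ (gap p) (gap q))) (lemma a b)
    where
    lemma : ∀ a b → (a - 1ℤ) * (b - 1ℤ) + (a - 1ℤ + (b - 1ℤ)) ≡ a * b - 1ℤ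
    lemma = solve-∀

  pos-part : ℤ → ℤ
  pos-part x = 0ℤ ⊔ x

  pos-part-≥0 : ∀ x → 0ℤ ≤ pos-part x
  pos-part-≥0 x = i≤i⊔j 0ℤ x

  pos-part-≥ : ∀ x → x ≤ pos-part x
  pos-part-≥ x = i≤j⊔i 0ℤ x

  pos-part-nonpos : ∀ {x} → x ≤ 0ℤ → pos-part x ≡ 0ℤ
  pos-part-nonpos = i≥j⇒i⊔j≡i

  pos-part-nonneg : ∀ {x} → 0ℤ ≤ x → pos-part x ≡ x
  pos-part-nonneg = i≤j⇒i⊔j≡j

  -- The square of the positive part is convex with second derivative at most 2.
  pos-part-sq : ∀ a d →
    pos-part (a - d) * pos-part (a - d) ≤ pos-part a * pos-part a - + 2 * pos-part a * d + d * d
  pos-part-sq a d = [ nonpos , nonneg ]′ (≤-total (a - d) 0ℤ)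
    where
    S = pos-part a
    square : ∀ s d → (s - d) * (s - d) ≡ s * s - + 2 * s * d + d * d
    square = solve-∀
    difference : ∀ s a d → (s - a) * (s - a + + 2 * (a - d)) ≡ s * s - + 2 * s * d + d * d - (a - d) * (a - d)
    difference = solve-∀
    nonpos : a - d ≤ 0ℤ → pos-part (a - d) * pos-part (a - d) ≤ S * S - + 2 * S * d + d * d
    nonpos ≤0 = subst₂ _≤_ (sym (cong₂ _*_ (pos-part-nonpos ≤0) (pos-part-nonpos ≤0))) (square S d) (0≤² (S - d))
    nonneg : 0ℤ ≤ a - d → pos-part (a - d) * pos-part (a - d) ≤ S * S - + 2 * S * d + d * d
    nonneg ≥0 = subst (_≤ S * S - + 2 * S * d + d * d) (sym (cong₂ _*_ (pos-part-nonneg ≥0) (pos-part-nonneg ≥0)))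
      (≤-by (0≤* (gap (pos-part-≥ a)) (0≤+ (gap (pos-part-≥ a)) (0≤* (0≤+n {2}) ≥0))) (difference S a d))

  ≤-from-sq : ∀ {a b} → 0ℤ ≤ b → a * a ≤ b * b → a ≤ b
  ≤-from-sq {a} {b} 0≤b a²≤b² with a ≤? b
  ... | yes a≤b = a≤b
  ... | no  a≰b = neg-absurd
    (0≤+ (gap a²≤b²) (0≤+ (0≤* q q) (0≤+ (0≤* (0≤+n {2}) (0≤* 0≤b q)) (0≤+ (0≤* (0≤+n {2}) 0≤b) (0≤* (0≤+n {2}) q)))))
    (lemma a b)
    where
    q = gap-< (≰⇒> a≰b)
    lemma : ∀ a b → b * b - a * a + ((a - b - 1ℤ) * (a - b - 1ℤ) + (+ 2 * (b * (a - b - 1ℤ)) + (+ 2 * b + + 2 * (a - b - 1ℤ)))) ≡ -1ℤ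
    lemma = solve-∀

  -- Cauchy-Schwarz for (as, t√X, t√Y) and (1/s, 1/√X, 1/√Y), whose inner product is a + 2t,
  -- multiplied by s²XY. The three squares are those of Lagrange's identity.
  cauchy : ∀ a t s X Y → 0ℤ ≤ X → 0ℤ ≤ Y →
    (a + t + t) * (a + t + t) * (s * s) * (X * Y) ≤
    (a * a * (s * s) + t * t * (X + Y)) * (X * Y + s * s * (X + Y))
  cauchy a t s X Y 0≤X 0≤Y = ≤-by
    (0≤+ (0≤+ (0≤* 0≤Y (0≤² (a * (s * s) - t * X))) (0≤* 0≤X (0≤² (a * (s * s) - t * Y))))
         (0≤* (0≤* (0≤² t) (0≤² s)) (0≤² (X - Y))))
    (lemma a t s X Y)
    where
    lemma : ∀ a t s X Y →
      Y * ((a * (s * s) - t * X) * (a * (s * s) - t * X)) + X * ((a * (s * s) - t * Y) * (a * (s * s) - t * Y))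
        + t * t * (s * s) * ((X - Y) * (X - Y)) ≡
      (a * a * (s * s) + t * t * (X + Y)) * (X * Y + s * s * (X + Y)) - (a + t + t) * (a + t + t) * (s * s) * (X * Y)
    lemma = solve-∀

  -- Put H = 1/s² + 1/X + 1/Y. The hypotheses say w ≤ MH, 4s²M < m and, after dividing the bounds on
  -- 2m and adding, 2mH ≤ 8ws². Hence 8ws² ≤ 8s²MH < 2mH ≤ 8ws².
  no-balance : ∀ {w s² X Y M m G₁ G₂ G₃} →
    0ℤ ≤ s² → 1ℤ ≤ X → 1ℤ ≤ Y →
    w * s² * (X * Y) ≤ M * (X * Y + s² * (X + Y)) →
    + 4 * s² * M < m →
    + 2 * m ≤ s² * G₁ → + 2 * m ≤ X * G₂ → + 2 * m ≤ Y * G₃ →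
    G₁ + G₂ + G₃ ≤ + 8 * w * s² → ⊥
  no-balance {w} {s²} {X} {Y} {M} {m} {G₁} {G₂} {G₃} 0≤s² 1≤X 1≤Y hM m> h₁ h₂ h₃ hG =
    neg-absurd
      (0≤+ (0≤+ (0≤+ (0≤+ (0≤+ (0≤+
        (0≤* 0≤XY (gap h₁)) (0≤* (0≤* 0≤s² 0≤Y) (gap h₂))) (0≤* (0≤* 0≤s² 0≤X) (gap h₃)))
        (0≤* (0≤* 0≤s² 0≤XY) (gap hG)))
        (0≤* (0≤* (0≤+n {2}) (gap-< m>)) (0≤+ 0≤XY (0≤* 0≤s² (0≤+ 0≤X 0≤Y)))))
        (0≤* (0≤* (0≤+n {8}) 0≤s²) (gap hM)))
        (0≤+ (0≤* (0≤+n {2}) (gap (1≤* 1≤X 1≤Y))) (0≤* (0≤* (0≤+n {2}) 0≤s²) (0≤+ 0≤X 0≤Y))))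
      (lemma w s² X Y M m G₁ G₂ G₃)
    where
    0≤X = 0≤≥1 1≤X
    0≤Y = 0≤≥1 1≤Y
    0≤XY = 0≤* 0≤X 0≤Y
    lemma : ∀ w s² X Y M m G₁ G₂ G₃ →
      X * Y * (s² * G₁ - + 2 * m) + s² * Y * (X * G₂ - + 2 * m) + s² * X * (Y * G₃ - + 2 * m)
      + s² * (X * Y) * (+ 8 * w * s² - (G₁ + G₂ + G₃))
      + + 2 * (m - + 4 * s² * M - 1ℤ) * (X * Y + s² * (X + Y))
      + + 8 * s² * (M * (X * Y + s² * (X + Y)) - w * s² * (X * Y))
      + (+ 2 * (X * Y - 1ℤ) + + 2 * s² * (X + Y)) ≡ - + 2
    lemma = solve-∀

  cancel-≤ : ∀ c {a b} → 1ℤ ≤ c → c * a ≤ c * b → a ≤ b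
  cancel-≤ c {a} {b} 1≤c ca≤cb with a ≤? b
  ... | yes a≤b = a≤b
  ... | no  a≰b = neg-absurd
    (0≤+ (gap ca≤cb) (0≤+ (0≤* (0≤≥1 1≤c) (gap-< (≰⇒> a≰b))) (gap 1≤c)))
    (lemma c a b)
    where
    lemma : ∀ c a b → c * b - c * a + (c * (a - b - 1ℤ) + (c - 1ℤ)) ≡ -1ℤ
    lemma = solve-∀

-- Discrete ascent and quadratic forms on multisets.

module LocalSearch where

  open Integers
  open import Data.Integer.Base hiding (suc; pred)
  open import Data.Integer.Properties hiding (_≟_)
  open import Data.Integer.Tactic.RingSolver using (solve-∀)
  open import Algebra.Properties.Semiring.Sum +-*-semiring
    using (sum; sum-cong-≗; ∑-distrib-+)

  _[_≔_] : ∀ {V : Set} {n} → Vector V n → Fin n → V → Vector V n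
  f [ i ≔ v ] = updateAt f i (const v)

  sum-update : ∀ {V : Set} {n} (g : V → ℤ) (f : Vector V n) i v →
               sum (g ∘ (f [ i ≔ v ])) ≡ sum (g ∘ f) + (g v - g (f i))
  sum-update {n = suc n} g f zero    v = lemma (g v) (g (f zero)) (sum (g ∘ f ∘ suc))
    where
    lemma : ∀ a b c → a + c ≡ b + c + (a - b)
    lemma = solve-∀
  sum-update {n = suc n} g f (suc i) v =
    trans (cong (_+_ (g (f zero))) (sum-update g (f ∘ suc) i v)) (sym (+-assoc (g (f zero)) _ _))

  -- Greedy ascent: each improving replacement raises the integer Φ, which is bounded.
  local-max : ∀ {V : Set} {n} (Φ : Vector V n → ℤ) B → (∀ f → Φ f ≤ B) → ∀ f₀ →
              ∃[ f ] Φ f₀ ≤ Φ f × (∀ i j → Φ (f [ i ≔ f j ]) ≤ Φ f)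
  local-max {V} {n} Φ B Φ≤B f₀ = ascend f₀ (<-wellFounded _)
    where
    slack : Vector V n → ℕ
    slack f = ∣ B - Φ f ∣
    slack-< : ∀ {f g} → Φ f < Φ g → slack g ℕ.< slack f
    slack-< {f} {g} lt = drop‿+<+ (subst₂ _<_
      (sym (0≤i⇒+∣i∣≡i (gap (Φ≤B g)))) (sym (0≤i⇒+∣i∣≡i (gap (Φ≤B f))))
      (+-monoʳ-< B (neg-mono-< lt)))
    ascend : ∀ f → Acc ℕ._<_ (slack f) → ∃[ g ] Φ f ≤ Φ g × (∀ i j → Φ (g [ i ≔ g j ]) ≤ Φ g)
    -- Only vertices already occurring in `f` are tried, so the search is finite for any `V`; all
    -- later comparisons are between positions of `f`.
    ascend f (acc rs) with any? (λ i → any? (λ j → Φ f <? Φ (f [ i ≔ f j ])))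
    ... | no ¬p = f , ≤-refl , λ i j → ≮⇒≥ (λ lt → ¬p (i , j , lt))
    ... | yes (i , j , lt) =
      let g , f≤g , max = ascend (f [ i ≔ f j ]) (rs (slack-< lt))
      in  g , ≤-trans (<⇒≤ lt) f≤g , max

  module Quadratic {V : Set} (M : V → V → ℤ) (M-sym : ∀ u v → M u v ≡ M v u) where

    lin : ∀ {n} → Vector V n → V → ℤ
    lin f u = sum (λ j → M u (f j))

    quad : ∀ {n} → Vector V n → ℤ
    quad f = sum (λ i → lin f (f i))

    -- Row `i` and column `i` both change, which by symmetry doubles the linear term. The last
    -- bracket corrects for `lin f` still seeing the old value at position `i`.
    quad-update : ∀ {n} (f : Vector V n) i v →
      quad (f [ i ≔ v ]) ≡
      quad f + (+ 2 * (lin f v - lin f (f i)) + (M v v + M (f i) (f i) - + 2 * M (f i) v))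
    quad-update f i v = begin
      quad f′
        ≡⟨ sum-cong-≗ (λ k → sum-update (M (f′ k)) f i v) ⟩
      sum (λ k → lin f (f′ k) + (M (f′ k) v - M (f′ k) u))
        ≡⟨ sum-update (λ w → lin f w + (M w v - M w u)) f i v ⟩
      sum (λ k → lin f (f k) + (M (f k) v - M (f k) u)) + (lin f v + (M v v - M v u) - (lin f u + (M u v - M u u)))
        ≡⟨ cong₂ (λ a b → a + (lin f v + (M v v - b) - (lin f u + (M u v - M u u))))
             (trans (∑-distrib-+ (λ k → lin f (f k)) _)
             (cong (_+_ (quad f)) (trans (∑-distrib-- (λ k → M (f k) v) _) (cong₂ _-_ (swap v) (swap u)))))
             (M-sym v u) ⟩
      quad f + (lin f v - lin f u) + (lin f v + (M v v - M u v) - (lin f u + (M u v - M u u)))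
        ≡⟨ lemma (quad f) (lin f v) (lin f u) (M v v) (M u u) (M u v) ⟩
      quad f + (+ 2 * (lin f v - lin f u) + (M v v + M u u - + 2 * M u v)) ∎
      where
      open ≡-Reasoning
      u = f i
      f′ = f [ i ≔ v ]
      swap : ∀ w → sum (λ k → M (f k) w) ≡ lin f w
      swap w = sum-cong-≗ (λ k → M-sym (f k) w)
      lemma : ∀ q a b c d e → q + (a - b) + (a + (c - e) - (b + (e - d))) ≡ q + (+ 2 * (a - b) + (c + d - + 2 * e))
      lemma = solve-∀

-- Colour sets of pairs, and triples of two-coloured pairs.

module Cells where

  open import Data.Integer.Base using (ℤ; +_; 0ℤ; 1ℤ; -1ℤ; _+_; _-_; _*_; _≤_; _<_; +≤+)
  open import Data.Integer.Properties as ℤ using (_≤?_; _<?_; +-mono-≤; ≤-trans)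
  open import Data.Integer.Tactic.RingSolver using (solve-∀)
  open Integers

  Colour : Set
  Colour = Fin 3

  -- two k is the set of all colours but k.
  data Cell : Set where
    none full : Cell
    one two   : Colour → Cell

  has : Cell → Colour → Bool
  has none    l = false
  has full    l = true
  has (one k) l = does (k ≟ l)
  has (two k) l = not (does (k ≟ l))

  indicator : Bool → ℤ
  indicator true  = 1ℤ
  indicator false = 0ℤ

  -- One less than the number of colours, so that the sum over ordered pairs is N²P.
  val : Cell → ℤ
  val none    = -1ℤ
  val (one k) = 0ℤ
  val (two k) = 1ℤ
  val full    = + 2

  Distinct : Colour → Colour → Colour → Set
  Distinct p q r = p ≢ q × q ≢ r × r ≢ p

  -- The constraint that a pair uv carrying all colours but k puts on the cells zu and zv.
  Compat : Colour → Cell → Cell → Set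
  Compat k a b = ∀ l → l ≢ k → ¬ (T (has a k) × T (has b l)) × ¬ (T (has b k) × T (has a l))

  compat? : ∀ k a b → Dec (Compat k a b)
  compat? k a b = all? λ l → ¬? (l ≟ k) →-dec
    ¬? (T? (has a k) ×-dec T? (has b l)) ×-dec ¬? (T? (has b k) ×-dec T? (has a l))

  distinct? : ∀ p q r → Dec (Distinct p q r)
  distinct? p q r = ¬? (p ≟ q) ×-dec ¬? (q ≟ r) ×-dec ¬? (r ≟ p)

  two? : ∀ k c → Dec (c ≡ two k)
  two? k none    = no λ ()
  two? k full    = no λ ()
  two? k (one l) = no λ ()
  two? k (two l) = map′ (cong two) (λ { refl → refl }) (l ≟ k)

  full? : ∀ c → Dec (c ≡ full)
  full? none    = no λ ()
  full? full    = yes refl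
  full? (one l) = no λ ()
  full? (two l) = no λ ()

  ∀cell? : {P : Cell → Set} → (∀ c → Dec (P c)) → Dec (∀ c → c ≢ full → P c)
  ∀cell? P? = map′
    (λ { (p , q , r) none _ → p
       ; (p , q , r) (one k) _ → q k
       ; (p , q , r) (two k) _ → r k
       ; (p , q , r) full c≢full → contradiction refl c≢full })
    (λ f → f none (λ ()) , (λ k → f (one k) λ ()) , (λ k → f (two k) λ ()))
    (P? none ×-dec all? (λ k → P? (one k)) ×-dec all? (λ k → P? (two k)))

  abstract
    -- Each variable is the cell from an arbitrary vertex z to the vertex of that name, and `Compat`
    -- records the edges of the configuration. This and the next statements are finite checks;
    -- `abstract` keeps them from being evaluated again where they are used.
    star-cells : ∀ p q r → Distinct p q r →
      ∀ v → v ≢ full → ∀ a → a ≢ full → Compat p v a → ∀ b → b ≢ full → Compat q v b →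
      ∀ c → c ≢ full → Compat r v c →
      val v + val a + (val v + val b) + (val v + val c) ≤ + 2
    star-cells = from-yes
      (all? λ p → all? λ q → all? λ r → distinct? p q r →-dec
       ∀cell? λ v → ∀cell? λ a → compat? p v a →-dec ∀cell? λ b → compat? q v b →-dec
       ∀cell? λ c → compat? r v c →-dec
       (val v + val a + (val v + val b) + (val v + val c) ≤? + 2))

    path₁-cells : ∀ p q r → Distinct p q r →
      ∀ u → u ≢ full → ∀ x → x ≢ full → Compat p u x → ∀ y → y ≢ full → Compat q x y →
      ∀ t → t ≢ full → Compat r y t →
      val u + val x + (val x + val y) + (val y + val t) ≤ + 2
    path₁-cells = from-yes
      (all? λ p → all? λ q → all? λ r → distinct? p q r →-dec
       ∀cell? λ u → ∀cell? λ x → compat? p u x →-dec ∀cell? λ y → compat? q x y →-dec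
       ∀cell? λ t → compat? r y t →-dec
       (val u + val x + (val x + val y) + (val y + val t) ≤? + 2))

    -- The second alternative lists the edges at z that a violation supplies. The fourth edge wy
    -- adds no weight; its constraint turns the final `⊎` of `cherry-cells` into a `×`, which is
    -- what makes a star at z possible.
    path₂-cells : ∀ p q r → Distinct p q r →
      ∀ u → u ≢ full → ∀ x → x ≢ full → Compat p u x → ∀ w → w ≢ full → Compat q x w →
      ∀ y → y ≢ full → Compat q w y → ∀ t → t ≢ full → Compat r y t →
      val u + val x + (val x + val w) + (val y + val t) ≤ + 2 ⊎
      (y ≡ two r ⊎ t ≡ two r) × ((x ≡ two p ⊎ x ≡ two q) ⊎ (u ≡ two p × w ≡ two q))
    path₂-cells = from-yes
      (all? λ p → all? λ q → all? λ r → distinct? p q r →-dec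
       ∀cell? λ u → ∀cell? λ x → compat? p u x →-dec ∀cell? λ w → compat? q x w →-dec
       ∀cell? λ y → compat? q w y →-dec ∀cell? λ t → compat? r y t →-dec
       ((val u + val x + (val x + val w) + (val y + val t) ≤? + 2) ⊎-dec
        (two? r y ⊎-dec two? r t) ×-dec ((two? p x ⊎-dec two? q x) ⊎-dec (two? p u ×-dec two? q w))))

    cherry-cells : ∀ p q r → Distinct p q r →
      ∀ u → u ≢ full → ∀ x → x ≢ full → Compat p u x → ∀ w → w ≢ full → Compat q x w →
      ∀ y → y ≢ full → ∀ t → t ≢ full → Compat r y t →
      val u + val x + (val x + val w) + (val y + val t) ≤ + 2 ⊎
      (y ≡ two r ⊎ t ≡ two r) × ((x ≡ two p ⊎ x ≡ two q) ⊎ (u ≡ two p ⊎ w ≡ two q))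
    cherry-cells = from-yes
      (all? λ p → all? λ q → all? λ r → distinct? p q r →-dec
       ∀cell? λ u → ∀cell? λ x → compat? p u x →-dec ∀cell? λ w → compat? q x w →-dec
       ∀cell? λ y → ∀cell? λ t → compat? r y t →-dec
       ((val u + val x + (val x + val w) + (val y + val t) ≤? + 2) ⊎-dec
        (two? r y ⊎-dec two? r t) ×-dec ((two? p x ⊎-dec two? q x) ⊎-dec (two? p u ⊎-dec two? q w))))

    edge-cells : ∀ k → ∀ a → a ≢ full → ∀ b → b ≢ full → Compat k a b →
      val a + val b ≤ 0ℤ ⊎ (a ≡ two k ⊎ b ≡ two k) × val a + val b ≤ + 2
    edge-cells = from-yes
      (all? λ k → ∀cell? λ a → ∀cell? λ b → compat? k a b →-dec
       ((val a + val b ≤? 0ℤ) ⊎-dec (two? k a ⊎-dec two? k b) ×-dec (val a + val b ≤? + 2)))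

  record Template (V : Set) : Set where
    field
      cell         : V → V → Cell
      cell-sym     : ∀ u v → cell u v ≡ cell v u
      cell-irrefl  : ∀ v → cell v v ≡ none
      rainbow-free : ∀ {i j k} → Distinct i j k → ∀ u v w →
                     ¬ (T (has (cell u v) i) × T (has (cell v w) j) × T (has (cell w u) k))

  -- Makes the positions of a multiset into vertices; copies of one vertex are joined by `none`,
  -- thanks to `cell-irrefl`.
  pullback : ∀ {U V} → (U → V) → Template V → Template U
  pullback f 𝒯 = record
    { cell         = λ u v → cell (f u) (f v)
    ; cell-sym     = λ u v → cell-sym (f u) (f v)
    ; cell-irrefl  = λ v → cell-irrefl (f v)
    ; rainbow-free = λ d u v w → rainbow-free d (f u) (f v) (f w)
    }
    where open Template 𝒯

  abstract
    third-colour : ∀ k l → k ≢ l → ∃[ m ] Distinct k m l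
    third-colour = from-yes (all? λ k → all? λ l → ¬? (k ≟ l) →-dec any? λ m → distinct? k m l)

    two-has : ∀ k l → l ≢ k → T (has (two k) l)
    two-has = from-yes (all? λ k → all? λ l → ¬? (l ≟ k) →-dec T? (has (two k) l))

  module _ {V : Set} (𝒯 : Template V) where
    open Template 𝒯

    -- Colours `k` and `l` on the two sides at z would be completed to a rainbow triangle by the
    -- remaining colour `m`, which uv carries because `m` differs from `k`.
    compat : ∀ k {u v} → (∀ m → m ≢ k → T (has (cell u v) m)) → ∀ z → Compat k (cell z u) (cell z v)
    compat k {u} {v} uv z l l≢k =
      let m , d@(k≢m , _ , _) = third-colour k l (l≢k ∘ sym) in
      (λ (zu , zv) → rainbow-free d z u v
         (zu , uv m (k≢m ∘ sym) , subst (λ c → T (has c l)) (cell-sym z v) zv)) ,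
      (λ (zv , zu) → rainbow-free d z v u
         (zv , subst (λ c → T (has c m)) (cell-sym u v) (uv m (k≢m ∘ sym))
             , subst (λ c → T (has c l)) (cell-sym z u) zu))

    compat-two : ∀ {k u v} → cell u v ≡ two k → ∀ z → Compat k (cell z u) (cell z v)
    compat-two {k} uv = compat k λ m m≢k → subst (λ c → T (has c m)) (sym uv) (two-has k m m≢k)

  rotate : ∀ {p q r} → Distinct p q r → Distinct q r p
  rotate (pq , qr , rp) = qr , rp , pq

  swap : ∀ {p q r} → Distinct p q r → Distinct q p r
  swap (pq , qr , rp) = pq ∘ sym , rp ∘ sym , qr ∘ sym

  ∀-or : ∀ {n} {P : Fin n → Set} {A : Set} → (∀ z → Dec (P z)) → (∀ z → ¬ P z → A) → (∀ z → P z) ⊎ A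
  ∀-or {n} {P} P? f with all? P?
  ... | yes ∀P = inj₁ ∀P
  ... | no ¬∀P = let z , ¬Pz = ¬∀⟶∃¬ n P P? ¬∀P in inj₂ (f z ¬Pz)

  -- If three edges, one of each kind, are not balanced, then a vertex z violating the
  -- inequality supplies edges of a tighter configuration: arbitrary edges are replaced by
  -- a cherry and an edge, then by path₂, then by path₁ or a star, which are always balanced.
  module Configuration {N : ℕ} (𝒯 : Template (Fin N))
                       (no-full : ∀ u v → Template.cell 𝒯 u v ≢ full) where
    open Template 𝒯 renaming (cell to C; cell-sym to C-sym)

    Edge : Colour → Fin N → Fin N → Set
    Edge k u v = C u v ≡ two k

    flip : ∀ {k u v} → Edge k u v → Edge k v u
    flip {u = u} {v} uv = trans (C-sym v u) uv

    weight : Fin N → Fin N → Fin N → ℤ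
    weight u v z = val (C z u) + val (C z v)

    record Balanced : Set where
      field
        {p q r}        : Colour
        distinct       : Distinct p q r
        {u u′ v v′ w w′} : Fin N
        p-edge         : Edge p u u′
        q-edge         : Edge q v v′
        r-edge         : Edge r w w′
        balance        : ∀ z → weight u u′ z + weight v v′ z + weight w w′ z ≤ + 2

    star : ∀ {p q r} → Distinct p q r → ∀ {v a b c} → Edge p v a → Edge q v b → Edge r v c → Balanced
    star {p} {q} {r} d e f g = record
      { distinct = d ; p-edge = e ; q-edge = f ; r-edge = g
      ; balance = λ z → star-cells p q r d _ (no-full z _) _ (no-full z _) (compat-two 𝒯 e z)
                          _ (no-full z _) (compat-two 𝒯 f z) _ (no-full z _) (compat-two 𝒯 g z) }

    path₁ : ∀ {p q r} → Distinct p q r → ∀ {u x y t} → Edge p u x → Edge q x y → Edge r y t → Balanced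
    path₁ {p} {q} {r} d e f g = record
      { distinct = d ; p-edge = e ; q-edge = f ; r-edge = g
      ; balance = λ z → path₁-cells p q r d _ (no-full z _) _ (no-full z _) (compat-two 𝒯 e z)
                          _ (no-full z _) (compat-two 𝒯 f z) _ (no-full z _) (compat-two 𝒯 g z) }

    balanced-or : ∀ {p q r} → Distinct p q r → ∀ {u u′ v v′ w w′} →
      Edge p u u′ → Edge q v v′ → Edge r w w′ →
      (∀ z → weight u u′ z + weight v v′ z + weight w w′ z ≤ + 2 ⊎ Balanced) → Balanced
    balanced-or d {u} {u′} {v} {v′} {w} {w′} e f g h
      with ∀-or (λ z → weight u u′ z + weight v v′ z + weight w w′ z ≤? + 2) from-violation
      where
      from-violation : ∀ z → ¬ (weight u u′ z + weight v v′ z + weight w w′ z ≤ + 2) → Balanced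
      from-violation z ≰ with h z
      ... | inj₁ ≤2 = contradiction ≤2 ≰
      ... | inj₂ b  = b
    ... | inj₁ all≤2 = record { distinct = d ; p-edge = e ; q-edge = f ; r-edge = g ; balance = all≤2 }
    ... | inj₂ b     = b

    endpoint : ∀ {k z u v} → Edge k z u ⊎ Edge k z v → ∃[ s ] Edge k z s
    endpoint (inj₁ e) = _ , e
    endpoint (inj₂ e) = _ , e

    path₂ : ∀ {p q r} → Distinct p q r → ∀ {u x w y t} →
            Edge p u x → Edge q x w → Edge q w y → Edge r y t → Balanced
    path₂ {p} {q} {r} d {u} {x} {w} {y} {t} e f f′ g = balanced-or d e f g improve
      where
      improve : ∀ z → weight u x z + weight x w z + weight y t z ≤ + 2 ⊎ Balanced
      improve z with path₂-cells p q r d _ (no-full z u) _ (no-full z x) (compat-two 𝒯 e z)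
                       _ (no-full z w) (compat-two 𝒯 f z) _ (no-full z y) (compat-two 𝒯 f′ z)
                       _ (no-full z t) (compat-two 𝒯 g z)
      ... | inj₁ ≤2 = inj₁ ≤2
      -- With s the other end of the r-edge at z, the new paths are w-x-z-s and u-x-z-s, and the
      -- star is centred at z.
      ... | inj₂ (zr , inj₁ (inj₁ zx)) = inj₂ (path₁ (swap d) (flip f) (flip zx) (proj₂ (endpoint zr)))
      ... | inj₂ (zr , inj₁ (inj₂ zx)) = inj₂ (path₁ d e (flip zx) (proj₂ (endpoint zr)))
      ... | inj₂ (zr , inj₂ (zu , zw)) = inj₂ (star d zu zw (proj₂ (endpoint zr)))

    cherry : ∀ {p q r} → Distinct p q r → ∀ {u x w y t} →
             Edge p u x → Edge q x w → Edge r y t → Balanced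
    cherry {p} {q} {r} d {u} {x} {w} {y} {t} e f g = balanced-or d e f g improve
      where
      improve : ∀ z → weight u x z + weight x w z + weight y t z ≤ + 2 ⊎ Balanced
      improve z with cherry-cells p q r d _ (no-full z u) _ (no-full z x) (compat-two 𝒯 e z)
                       _ (no-full z w) (compat-two 𝒯 f z) _ (no-full z y) _ (no-full z t) (compat-two 𝒯 g z)
      ... | inj₁ ≤2 = inj₁ ≤2
      ... | inj₂ (zr , inj₁ (inj₁ zx)) = inj₂ (path₁ (swap d) (flip f) (flip zx) (proj₂ (endpoint zr)))
      ... | inj₂ (zr , inj₁ (inj₂ zx)) = inj₂ (path₁ d e (flip zx) (proj₂ (endpoint zr)))
      ... | inj₂ (zr , inj₂ (inj₁ zu)) = inj₂ (path₂ (swap d) (flip f) (flip e) (flip zu) (proj₂ (endpoint zr)))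
      ... | inj₂ (zr , inj₂ (inj₂ zw)) = inj₂ (path₂ d e f (flip zw) (proj₂ (endpoint zr)))

    balanced : ∀ {p q r} → Distinct p q r → ∀ {u u′ v v′ w w′} →
               Edge p u u′ → Edge q v v′ → Edge r w w′ → Balanced
    balanced {p} {q} {r} d {u} {u′} {v} {v′} {w} {w′} e f g = balanced-or d e f g improve
      where
      split : ∀ {k a b} → Edge k a b → ∀ z →
              weight a b z ≤ 0ℤ ⊎ (Edge k z a ⊎ Edge k z b) × weight a b z ≤ + 2
      split {k} {a} {b} ab z = edge-cells k _ (no-full z a) _ (no-full z b) (compat-two 𝒯 ab z)
      improve : ∀ z → weight u u′ z + weight v v′ z + weight w w′ z ≤ + 2 ⊎ Balanced
      improve z with split e z | split f z | split g z
      ... | inj₁ a       | inj₁ b       | inj₁ c       = inj₁ (≤-trans (+-mono-≤ (+-mono-≤ a b) c) (+≤+ z≤n))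
      ... | inj₁ a       | inj₁ b       | inj₂ (_ , c) = inj₁ (+-mono-≤ (+-mono-≤ a b) c)
      ... | inj₁ a       | inj₂ (_ , b) | inj₁ c       = inj₁ (+-mono-≤ (+-mono-≤ a b) c)
      ... | inj₂ (_ , a) | inj₁ b       | inj₁ c       = inj₁ (+-mono-≤ (+-mono-≤ a b) c)
      -- Two kinds have an edge at z: these two form a cherry with centre z, and the given edge of
      -- the third kind is kept.
      ... | inj₂ (zu , _) | inj₂ (zv , _) | _ = inj₂ (cherry d (flip (proj₂ (endpoint zu))) (proj₂ (endpoint zv)) g)
      ... | inj₂ (zu , _) | inj₁ _ | inj₂ (zw , _) = inj₂ (cherry (swap (rotate (rotate d))) (flip (proj₂ (endpoint zu))) (proj₂ (endpoint zw)) f)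
      ... | inj₁ _ | inj₂ (zv , _) | inj₂ (zw , _) = inj₂ (cherry (rotate d) (flip (proj₂ (endpoint zv))) (proj₂ (endpoint zw)) e)

  -- Sums over the three colours and pointwise bounds on cells.

  Σ₃ : (Colour → ℤ) → ℤ
  Σ₃ t = t 0F + t 1F + t 2F

  Σ₃-≥-term : ∀ {t} → (∀ k → 0ℤ ≤ t k) → ∀ k → t k ≤ Σ₃ t
  Σ₃-≥-term {t} 0≤t 0F = ≤-by (0≤+ (0≤t 1F) (0≤t 2F)) (lemma (t 0F) (t 1F) (t 2F))
    where
    lemma : ∀ a b c → b + c ≡ a + b + c - a
    lemma = solve-∀
  Σ₃-≥-term {t} 0≤t 1F = ≤-by (0≤+ (0≤t 0F) (0≤t 2F)) (lemma (t 0F) (t 1F) (t 2F))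
    where
    lemma : ∀ a b c → a + c ≡ a + b + c - b
    lemma = solve-∀
  Σ₃-≥-term {t} 0≤t 2F = ≤-by (0≤+ (0≤t 0F) (0≤t 1F)) (lemma (t 0F) (t 1F) (t 2F))
    where
    lemma : ∀ a b c → a + b ≡ a + b + c - c
    lemma = solve-∀

  Σ₃-≤-term : ∀ {t} p → (∀ k → k ≢ p → t k ≤ 0ℤ) → Σ₃ t ≤ t p
  Σ₃-≤-term {t} 0F t≤0 = ≤-by (0≤+ (gap (t≤0 1F λ ())) (gap (t≤0 2F λ ()))) (lemma (t 0F) (t 1F) (t 2F))
    where
    lemma : ∀ a b c → (0ℤ - b) + (0ℤ - c) ≡ a - (a + b + c)
    lemma = solve-∀
  Σ₃-≤-term {t} 1F t≤0 = ≤-by (0≤+ (gap (t≤0 0F λ ())) (gap (t≤0 2F λ ()))) (lemma (t 0F) (t 1F) (t 2F))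
    where
    lemma : ∀ a b c → (0ℤ - a) + (0ℤ - c) ≡ b - (a + b + c)
    lemma = solve-∀
  Σ₃-≤-term {t} 2F t≤0 = ≤-by (0≤+ (gap (t≤0 0F λ ())) (gap (t≤0 1F λ ()))) (lemma (t 0F) (t 1F) (t 2F))
    where
    lemma : ∀ a b c → (0ℤ - a) + (0ℤ - b) ≡ c - (a + b + c)
    lemma = solve-∀

  abstract
    permutations : ∀ p q r → Distinct p q r →
      (p ≡ 0F × q ≡ 1F × r ≡ 2F) ⊎ (p ≡ 0F × q ≡ 2F × r ≡ 1F) ⊎ (p ≡ 1F × q ≡ 0F × r ≡ 2F) ⊎
      (p ≡ 1F × q ≡ 2F × r ≡ 0F) ⊎ (p ≡ 2F × q ≡ 0F × r ≡ 1F) ⊎ (p ≡ 2F × q ≡ 1F × r ≡ 0F)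
    permutations = from-yes (all? λ p → all? λ q → all? λ r → distinct? p q r →-dec
      (((p ≟ 0F) ×-dec (q ≟ 1F) ×-dec (r ≟ 2F)) ⊎-dec ((p ≟ 0F) ×-dec (q ≟ 2F) ×-dec (r ≟ 1F)) ⊎-dec
       ((p ≟ 1F) ×-dec (q ≟ 0F) ×-dec (r ≟ 2F)) ⊎-dec ((p ≟ 1F) ×-dec (q ≟ 2F) ×-dec (r ≟ 0F)) ⊎-dec
       ((p ≟ 2F) ×-dec (q ≟ 0F) ×-dec (r ≟ 1F)) ⊎-dec ((p ≟ 2F) ×-dec (q ≟ 1F) ×-dec (r ≟ 0F))))

    is-one-of : ∀ p q r → Distinct p q r → ∀ k → k ≡ p ⊎ k ≡ q ⊎ k ≡ r
    is-one-of = from-yes (all? λ p → all? λ q → all? λ r → distinct? p q r →-dec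
      all? λ k → (k ≟ p) ⊎-dec (k ≟ q) ⊎-dec (k ≟ r))

  Σ₃-permute : ∀ {p q r} → Distinct p q r → ∀ t → Σ₃ t ≡ t p + t q + t r
  Σ₃-permute {p} {q} {r} d t = by-cases (permutations p q r d)
    where
    a = t 0F
    b = t 1F
    c = t 2F
    acb : ∀ a b c → a + b + c ≡ a + c + b
    acb = solve-∀
    bac : ∀ a b c → a + b + c ≡ b + a + c
    bac = solve-∀
    bca : ∀ a b c → a + b + c ≡ b + c + a
    bca = solve-∀
    cab : ∀ a b c → a + b + c ≡ c + a + b
    cab = solve-∀
    cba : ∀ a b c → a + b + c ≡ c + b + a
    cba = solve-∀
    by-cases : _ → a + b + c ≡ t p + t q + t r
    by-cases (inj₁ (refl , refl , refl)) = refl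
    by-cases (inj₂ (inj₁ (refl , refl , refl))) = acb a b c
    by-cases (inj₂ (inj₂ (inj₁ (refl , refl , refl)))) = bac a b c
    by-cases (inj₂ (inj₂ (inj₂ (inj₁ (refl , refl , refl))))) = bca a b c
    by-cases (inj₂ (inj₂ (inj₂ (inj₂ (inj₁ (refl , refl , refl)))))) = cab a b c
    by-cases (inj₂ (inj₂ (inj₂ (inj₂ (inj₂ (refl , refl , refl)))))) = cba a b c

  -- One less than the number of colours other than `k`; the sum over ordered pairs is N²Q_k.
  qval : Colour → Cell → ℤ
  qval k c = val c - indicator (has c k)

  all-cells? : {P : Cell → Set} → (∀ c → Dec (P c)) → Dec (∀ c → P c)
  all-cells? P? = map′
    (λ { (p , q , r , s) none → p
       ; (p , q , r , s) full → q
       ; (p , q , r , s) (one k) → r k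
       ; (p , q , r , s) (two k) → s k })
    (λ f → f none , f full , f ∘ one , f ∘ two)
    (P? none ×-dec P? full ×-dec all? (P? ∘ one) ×-dec all? (P? ∘ two))

  abstract
    val-bounds : ∀ c → -1ℤ ≤ val c × val c ≤ + 2
    val-bounds = from-yes (all-cells? λ c → (-1ℤ ≤? val c) ×-dec (val c ≤? + 2))

    qval-bounds : ∀ k c → (-1ℤ ≤ qval k c × qval k c ≤ 1ℤ) × qval k c ≤ val c
    qval-bounds = from-yes (all? λ k → all-cells? λ c →
      ((-1ℤ ≤? qval k c) ×-dec (qval k c ≤? 1ℤ)) ×-dec (qval k c ≤? val c))

    2val : ∀ c → + 2 * val c ≡ 1ℤ + Σ₃ (λ k → qval k c)
    2val = from-yes (all-cells? λ c → (+ 2 * val c) ℤ.≟ (1ℤ + Σ₃ (λ k → qval k c)))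

    qval>0⇒two : ∀ k c → c ≢ full → 0ℤ < qval k c → c ≡ two k
    qval>0⇒two = from-yes (all? λ k → ∀cell? λ c → (0ℤ <? qval k c) →-dec two? k c)

    -- If `k` lies in one cell, `Compat` leaves at most `k` for the other; if it lies in neither,
    -- each has at most one colour other than `l`. Either way at most two colours other than `l`
    -- occur in total.
    qval-across-edge : ∀ k l → l ≢ k → ∀ a → a ≢ full → ∀ b → b ≢ full → Compat k a b →
                       qval l a + qval l b ≤ 0ℤ
    qval-across-edge = from-yes (all? λ k → all? λ l → ¬? (l ≟ k) →-dec ∀cell? λ a → ∀cell? λ b →
      compat? k a b →-dec (qval l a + qval l b ≤? 0ℤ))

    -- Different colours cannot face each other, so one cell is empty or both consist of the same
    -- single colour.
    cells-across-full : ∀ a b → (∀ k → Compat k a b) →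
                        val a + val b ≤ 1ℤ × (∀ l → qval l a + qval l b ≤ 0ℤ)
    cells-across-full = from-yes (all-cells? λ a → all-cells? λ b → all? (λ k → compat? k a b) →-dec
      ((val a + val b ≤? 1ℤ) ×-dec all? λ l → qval l a + qval l b ≤? 0ℤ))

-- Penalised local maxima and the contradiction at them.

module Penalty where

  open Integers
  open LocalSearch
  open Cells
  open import Data.Integer.Base hiding (suc; pred)
  open import Data.Integer.Properties hiding (_≟_)
  open import Data.Integer.Tactic.RingSolver using (solve-∀)
  open import Algebra.Properties.Semiring.Sum +-*-semiring
    using (sum; sum-cong-≗; ∑-distrib-+; *-distribˡ-sum)

  -- The coefficient 2W² is made for this: the penalty costs no more than the potential can have
  -- gained, so 2W²S² ≤ s²P ≤ 8W²s⁴. A shortfall of 2s² below `threshold` still leaves Q_k ≥ 4s²Θ²,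
  -- as R ≥ 1.
  bounded-penalty : ∀ {s W P P₀ Σ S} → 1ℤ ≤ s → 1ℤ ≤ W → 0ℤ ≤ P₀ → S * S ≤ Σ →
    s * s * P₀ ≤ s * s * P - + 2 * (W * W) * Σ → P ≤ + 8 * (W * W) * (s * s) →
    S ≤ + 2 * (s * s)
  bounded-penalty {s} {W} {P} {P₀} {Σ} {S} 1≤s 1≤W 0≤P₀ S²≤Σ Φ≥ P≤ =
    ≤-from-sq (0≤* (0≤+n {2}) (0≤² s)) (cancel-≤ (+ 2 * (W * W)) 1≤2WW (≤-by
      (0≤+ (0≤+ (0≤+ (0≤* 0≤2WW (gap S²≤Σ)) (gap Φ≥)) (0≤* (0≤² s) (gap P≤))) (0≤* (0≤² s) 0≤P₀))
      (lemma s W P P₀ Σ S)))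
    where
    0≤2WW = 0≤* (0≤+n {2}) (0≤² W)
    1≤2WW : 1ℤ ≤ + 2 * (W * W)
    1≤2WW = 1≤* {+ 2} (+≤+ (ℕ.s≤s ℕ.z≤n)) (1≤* 1≤W 1≤W)
    lemma : ∀ s W P P₀ Σ S →
      + 2 * (W * W) * (Σ - S * S) + (s * s * P - + 2 * (W * W) * Σ - s * s * P₀)
        + s * s * (+ 8 * (W * W) * (s * s) - P) + s * s * P₀ ≡
      + 2 * (W * W) * (+ 2 * (s * s) * (+ 2 * (s * s))) - + 2 * (W * W) * (S * S)
    lemma = solve-∀

  penalised-≤ : ∀ {s W P P₀ Σ} → 1ℤ ≤ s → 0ℤ ≤ Σ →
    s * s * P₀ ≤ s * s * P - + 2 * (W * W) * Σ → P₀ ≤ P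
  penalised-≤ {s} {W} {P} {P₀} {Σ} 1≤s 0≤Σ Φ≥ = cancel-≤ (s * s) (1≤* 1≤s 1≤s)
    (≤-trans Φ≥ (≤-by (0≤* (0≤* (0≤+n {2}) (0≤² W)) 0≤Σ) (lemma (s * s * P) (+ 2 * (W * W) * Σ))))
    where
    lemma : ∀ a b → b ≡ a - (a - b)
    lemma = solve-∀

  -- First-order change of one penalty term when a form changes by 2d + ε.
  penalty-change : ∀ {s W N S S′ d ε} → 1ℤ ≤ N → 0ℤ ≤ S → S ≤ + 2 * (s * s) →
    S′ * S′ ≤ S * S - + 2 * S * (+ 2 * d + ε) + (+ 2 * d + ε) * (+ 2 * d + ε) →
    - + 4 ≤ ε → ε ≤ 0ℤ → - (+ 2 * N) ≤ d → d ≤ + 2 * N →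
    + 2 * (W * W) * (S′ * S′) + + 8 * (W * W) * (S * d) ≤
    + 2 * (W * W) * (S * S) + (+ 32 * (W * W) * (s * s) + + 128 * (W * W) * (N * N))
  penalty-change {s} {W} {N} {S} {S′} {d} {ε} 1≤N 0≤S S≤ convex -4≤ε ε≤0 -2N≤d d≤2N = ≤-by
    (0≤+ (0≤+ (0≤+ (0≤* 0≤2WW (gap convex)) (0≤* (0≤* (0≤* (0≤+n {4}) (0≤² W)) 0≤S) (gap -4≤ε)))
      (0≤* (0≤* (0≤+n {16}) (0≤² W)) (gap S≤)))
      (0≤* 0≤2WW (0≤* Δ≤ Δ≥)))
    (lemma s W N S S′ d ε)
    where
    0≤2WW = 0≤* (0≤+n {2}) (0≤² W)
    lem₁ : ∀ N d ε → + 2 * (+ 2 * N - d) + (0ℤ - ε) + + 4 * N ≡ + 8 * N - (+ 2 * d + ε)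
    lem₁ = solve-∀
    lem₂ : ∀ N d ε → + 2 * (d - - (+ 2 * N)) + (ε - - + 4) + + 4 * (N - 1ℤ) ≡ + 8 * N + (+ 2 * d + ε)
    lem₂ = solve-∀
    Δ≤ : 0ℤ ≤ + 8 * N - (+ 2 * d + ε)
    Δ≤ = subst (0ℤ ≤_) (lem₁ N d ε)
      (0≤+ (0≤+ (0≤* (0≤+n {2}) (gap d≤2N)) (gap ε≤0)) (0≤* (0≤+n {4}) (0≤≥1 1≤N)))
    Δ≥ : 0ℤ ≤ + 8 * N + (+ 2 * d + ε)
    Δ≥ = subst (0ℤ ≤_) (lem₂ N d ε)
      (0≤+ (0≤+ (0≤* (0≤+n {2}) (gap -2N≤d)) (gap -4≤ε)) (0≤* (0≤+n {4}) (gap 1≤N)))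
    lemma : ∀ s W N S S′ d ε →
      + 2 * (W * W) * (S * S - + 2 * S * (+ 2 * d + ε) + (+ 2 * d + ε) * (+ 2 * d + ε) - S′ * S′)
        + + 4 * (W * W) * S * (ε - - + 4)
        + + 16 * (W * W) * (+ 2 * (s * s) - S)
        + + 2 * (W * W) * ((+ 8 * N - (+ 2 * d + ε)) * (+ 8 * N + (+ 2 * d + ε))) ≡
      + 2 * (W * W) * (S * S) + (+ 32 * (W * W) * (s * s) + + 128 * (W * W) * (N * N))
        - (+ 2 * (W * W) * (S′ * S′) + + 8 * (W * W) * (S * d))
    lemma = solve-∀

  -- With N = 2Ws the three colours err by 3(32W²s² + 512W⁴s²) and `ε` by 6s², at most 1638W⁴s² in
  -- all since W ≥ 1. Forms change by twice the gradient, so half of this must fit under the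
  -- tolerance.
  tolerance : ℤ → ℤ → ℤ
  tolerance W s = + 1000 * (W * W * (W * W)) * (s * s)

  first-order : ∀ {s W P D ε} (S S′ d : Colour → ℤ) → 1ℤ ≤ W → - + 6 ≤ ε →
    (∀ k → + 2 * (W * W) * (S′ k * S′ k) + + 8 * (W * W) * (S k * d k) ≤
           + 2 * (W * W) * (S k * S k) +
           (+ 32 * (W * W) * (s * s) + + 128 * (W * W) * (+ 2 * W * s * (+ 2 * W * s)))) →
    s * s * (P + (+ 2 * D + ε)) - + 2 * (W * W) * Σ₃ (λ k → S′ k * S′ k) ≤
    s * s * P - + 2 * (W * W) * Σ₃ (λ k → S k * S k) →
    s * s * D + + 4 * (W * W) * Σ₃ (λ k → S k * d k) ≤ tolerance W s
  first-order {s} {W} {P} {D} {ε} S S′ d 1≤W -6≤ε change max =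
    cancel-≤ (+ 2) (+≤+ (ℕ.s≤s ℕ.z≤n)) (≤-by
    (0≤+ (0≤+ (0≤+ (0≤+ (0≤+ (gap max) (gap (change 0F))) (gap (change 1F))) (gap (change 2F)))
         (0≤* (0≤² s) (gap -6≤ε)))
      -- 362 = 2000 - 3·512 - 3·32 - 6; the factors W² - 1 raise the lower powers of W to W⁴.
      (0≤* (0≤² s) (0≤+ (0≤* (0≤+n {362}) 0≤WWWW) (0≤+ (0≤* (0≤* (0≤+n {96}) (0≤² W)) 0≤WW-1)
        (0≤* (0≤+n {6}) (0≤+ (0≤* (0≤² W) 0≤WW-1) 0≤WW-1))))))
    (lemma (s * s) (W * W) P D ε (S 0F) (S 1F) (S 2F) (S′ 0F * S′ 0F) (S′ 1F * S′ 1F) (S′ 2F * S′ 2F) (d 0F) (d 1F) (d 2F) _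
      (square W s)))
    where
    0≤WWWW = 0≤* (0≤² W) (0≤² W)
    0≤WW-1 = gap (1≤* 1≤W 1≤W)
    square : ∀ W s → + 2 * W * s * (+ 2 * W * s) ≡ + 4 * (W * W) * (s * s)
    square = solve-∀
    expand : ∀ s² W² P D ε S₀ S₁ S₂ T₀ T₁ T₂ d₀ d₁ d₂ →
      s² * P - + 2 * W² * (S₀ * S₀ + S₁ * S₁ + S₂ * S₂) - (s² * (P + (+ 2 * D + ε)) - + 2 * W² * (T₀ + T₁ + T₂))
      + (+ 2 * W² * (S₀ * S₀) + (+ 32 * W² * s² + + 128 * W² * (+ 4 * W² * s²)) - (+ 2 * W² * T₀ + + 8 * W² * (S₀ * d₀)))
      + (+ 2 * W² * (S₁ * S₁) + (+ 32 * W² * s² + + 128 * W² * (+ 4 * W² * s²)) - (+ 2 * W² * T₁ + + 8 * W² * (S₁ * d₁)))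
      + (+ 2 * W² * (S₂ * S₂) + (+ 32 * W² * s² + + 128 * W² * (+ 4 * W² * s²)) - (+ 2 * W² * T₂ + + 8 * W² * (S₂ * d₂)))
      + s² * (ε - - + 6)
      + s² * (+ 362 * (W² * W²) + (+ 96 * W² * (W² - 1ℤ) + + 6 * (W² * (W² - 1ℤ) + (W² - 1ℤ)))) ≡
      + 2 * (+ 1000 * (W² * W²) * s²) - + 2 * (s² * D + + 4 * W² * (S₀ * d₀ + S₁ * d₁ + S₂ * d₂))
    expand = solve-∀
    lemma : ∀ s² W² P D ε S₀ S₁ S₂ T₀ T₁ T₂ d₀ d₁ d₂ N² → N² ≡ + 4 * W² * s² →
      s² * P - + 2 * W² * (S₀ * S₀ + S₁ * S₁ + S₂ * S₂) - (s² * (P + (+ 2 * D + ε)) - + 2 * W² * (T₀ + T₁ + T₂))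
      + (+ 2 * W² * (S₀ * S₀) + (+ 32 * W² * s² + + 128 * W² * N²) - (+ 2 * W² * T₀ + + 8 * W² * (S₀ * d₀)))
      + (+ 2 * W² * (S₁ * S₁) + (+ 32 * W² * s² + + 128 * W² * N²) - (+ 2 * W² * T₁ + + 8 * W² * (S₁ * d₁)))
      + (+ 2 * W² * (S₂ * S₂) + (+ 32 * W² * s² + + 128 * W² * N²) - (+ 2 * W² * T₂ + + 8 * W² * (S₂ * d₂)))
      + s² * (ε - - + 6)
      + s² * (+ 362 * (W² * W²) + (+ 96 * W² * (W² - 1ℤ) + + 6 * (W² * (W² - 1ℤ) + (W² - 1ℤ)))) ≡
      + 2 * (+ 1000 * (W² * W²) * s²) - + 2 * (s² * D + + 4 * W² * (S₀ * d₀ + S₁ * d₁ + S₂ * d₂))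
    lemma s² W² P D ε S₀ S₁ S₂ T₀ T₁ T₂ d₀ d₁ d₂ _ refl = expand s² W² P D ε S₀ S₁ S₂ T₀ T₁ T₂ d₀ d₁ d₂

  -- With colour p unpenalised, Λ minus the accumulated error satisfies the hypothesis on m of `no-balance`.
  lagrangian-large : ∀ {s W Θ R P Q₁ Q₂ S₁ S₂} → 1ℤ ≤ W → 1ℤ ≤ R → 1ℤ ≤ s →
    + 1000 * (W * W * (W * W) * W) ≤ s → + 9 * (R + Θ * Θ) + W * W ≡ + 8 * Θ * W →
    + 4 * (W * W) * (s * s) + + 12 * (s * s) * (R + Θ * Θ) ≤ + 2 * P →
    0ℤ ≤ S₁ → 0ℤ ≤ S₂ → + 4 * (s * s) * (Θ * Θ) ≤ Q₁ → + 4 * (s * s) * (Θ * Θ) ≤ Q₂ →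
    + 4 * (s * s) * ((W - Θ - Θ) * (W - Θ - Θ) * (s * s)
                     + Θ * Θ * (s * s + + 4 * (W * W) * S₁ + (s * s + + 4 * (W * W) * S₂))) <
    s * s * P + + 4 * (W * W) * (S₁ * Q₁ + S₂ * Q₂) - + 2 * W * s * tolerance W s
  lagrangian-large {s} {W} {Θ} {R} {P} {Q₁} {Q₂} {S₁} {S₂} 1≤W 1≤R 1≤s s≥ param P≥ 0≤S₁ 0≤S₂ Q₁≥ Q₂≥ =
    suc[i]≤j⇒i<j (cancel-≤ (+ 2) (+≤+ (ℕ.s≤s ℕ.z≤n)) (≤-by
      (0≤+ (0≤+ (0≤+ (0≤+ (0≤+
        (0≤* (0≤² s) (gap P≥))
        (0≤* (0≤* (0≤* (0≤+n {8}) (0≤² W)) 0≤S₁) (gap Q₁≥)))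
        (0≤* (0≤* (0≤* (0≤+n {8}) (0≤² W)) 0≤S₂) (gap Q₂≥)))
        (0≤* (0≤* (0≤+n {4}) 0≤sss) (gap s≥)))
        -- The surplus 6(y - θ²) is 48s⁴R at this scale. Since R ≥ 1 it pays for the accumulated
        -- tolerance, which is at most 4s⁴ because s ≥ 1000W⁵, and for strictness.
        (0≤+ (0≤* (0≤* (0≤+n {48}) (0≤* (0≤² s) (0≤² s))) (gap 1≤R))
             (0≤+ (0≤* (0≤+n {2}) (gap (1≤* (1≤* 1≤s 1≤s) (1≤* 1≤s 1≤s)))) (0≤* (0≤+n {42}) (0≤* (0≤² s) (0≤² s))))))
        (0≤* (0≤* (0≤+n {4}) (0≤* (0≤² s) (0≤² s))) (gap (≤-reflexive param))))
      (lemma (+ 1000) s W Θ R P Q₁ Q₂ S₁ S₂)))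
    where
    0≤sss = 0≤* (0≤² s) (0≤≥1 1≤s)
    lemma : ∀ K s W Θ R P Q₁ Q₂ S₁ S₂ →
      s * s * (+ 2 * P - (+ 4 * (W * W) * (s * s) + + 12 * (s * s) * (R + Θ * Θ)))
      + + 8 * (W * W) * S₁ * (Q₁ - + 4 * (s * s) * (Θ * Θ))
      + + 8 * (W * W) * S₂ * (Q₂ - + 4 * (s * s) * (Θ * Θ))
      + + 4 * (s * s * s) * (s - K * (W * W * (W * W) * W))
      + (+ 48 * (s * s * (s * s)) * (R - 1ℤ) + (+ 2 * (s * s * (s * s) - 1ℤ) + + 42 * (s * s * (s * s))))
      + + 4 * (s * s * (s * s)) * (+ 8 * Θ * W - (+ 9 * (R + Θ * Θ) + W * W)) ≡
      + 2 * (s * s * P + + 4 * (W * W) * (S₁ * Q₁ + S₂ * Q₂) - + 2 * W * s * (K * (W * W * (W * W)) * (s * s)))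
      - + 2 * (1ℤ + + 4 * (s * s) * ((W - Θ - Θ) * (W - Θ - Θ) * (s * s)
                     + Θ * Θ * (s * s + + 4 * (W * W) * S₁ + (s * s + + 4 * (W * W) * S₂))))
    lemma = solve-∀

  -- θ = Θ/W and y − θ² = R/W²; θ-eq says that θ = (9y + 1)/8.
  record Scale (N : ℕ) : Set where
    field
      W Θ R s : ℤ
      1≤W     : 1ℤ ≤ W
      1≤Θ     : 1ℤ ≤ Θ
      1≤R     : 1ℤ ≤ R
      1≤s     : 1ℤ ≤ s
      N≡2Ws   : + N ≡ + 2 * W * s
      s-large : + 1000 * (W * W * (W * W) * W) ≤ s
      θ-eq    : + 9 * (R + Θ * Θ) + W * W ≡ + 8 * Θ * W

  module Penalised {V : Set} (𝒯 : Template V) {N : ℕ} (scale : Scale N) where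
    open Template 𝒯
    open Scale scale

    module P = Quadratic (λ u v → val (cell u v)) (λ u v → cong val (cell-sym u v))
    module Q (k : Colour) = Quadratic (λ u v → qval k (cell u v)) (λ u v → cong (qval k) (cell-sym u v))

    -- As N² = 4W²s², the bound y becomes 4s²Z, and `threshold` is TN² for T the midpoint of θ² and
    -- y.
    Z threshold : ℤ
    Z = R + Θ * Θ
    threshold = + 4 * (s * s) * Z - + 2 * (s * s) * R

    S : Vector V N → Colour → ℤ
    S f k = pos-part (threshold - Q.quad k f)

    penalty : Vector V N → ℤ
    penalty f = Σ₃ (λ k → S f k * S f k)

    Φ : Vector V N → ℤ
    Φ f = s * s * P.quad f - + 2 * (W * W) * penalty f

    N² : + N * + N ≡ + 4 * (W * W) * (s * s)
    N² = trans (cong₂ _*_ N≡2Ws N≡2Ws) (square W s)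
      where
      square : ∀ W s → + 2 * W * s * (+ 2 * W * s) ≡ + 4 * (W * W) * (s * s)
      square = solve-∀

    sum-≤-const : ∀ {t : Vector ℤ N} {c} → (∀ i → t i ≤ c) → sum t ≤ + N * c
    sum-≤-const {t} {c} t≤c = ≤-trans (sum-mono t≤c) (≤-reflexive (sum-const N c))

    const-≤-sum : ∀ {t : Vector ℤ N} {c} → (∀ i → c ≤ t i) → + N * c ≤ sum t
    const-≤-sum {t} {c} c≤t = ≤-trans (≤-reflexive (sym (sum-const N c))) (sum-mono c≤t)

    P-bound : ∀ f → P.quad f ≤ + 8 * (W * W) * (s * s)
    P-bound f = ≤-trans (sum-≤-const (λ i → sum-≤-const (λ j → proj₂ (val-bounds (cell (f i) (f j))))))
      (≤-reflexive (trans (sym (*-assoc (+ N) (+ N) (+ 2))) (trans (cong (_* + 2) N²) (lemma (W * W) (s * s)))))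
      where
      lemma : ∀ a b → + 4 * a * b * + 2 ≡ + 8 * a * b
      lemma = solve-∀

    penalty-≥0 : ∀ f → 0ℤ ≤ penalty f
    penalty-≥0 f = 0≤+ (0≤+ (0≤² (S f 0F)) (0≤² (S f 1F))) (0≤² (S f 2F))

    Φ-bound : ∀ f → Φ f ≤ s * s * (+ 8 * (W * W) * (s * s))
    Φ-bound f = ≤-by
      (0≤+ (0≤* (0≤² s) (gap (P-bound f))) (0≤* (0≤* (0≤+n {2}) (0≤² W)) (penalty-≥0 f)))
      (lemma (s * s) (P.quad f) (+ 8 * (W * W) * (s * s)) (+ 2 * (W * W) * penalty f))
      where
      lemma : ∀ a p b c → a * (b - p) + c ≡ a * b - (a * p - c)
      lemma = solve-∀

    2P : ∀ f → + 2 * P.quad f ≡ + 4 * (W * W) * (s * s) + Σ₃ (λ k → Q.quad k f)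
    2P f = begin
      + 2 * P.quad f
        ≡⟨ trans (*-distribˡ-sum (+ 2) (λ i → P.lin f (f i)))
                 (sum-cong-≗ (λ i → *-distribˡ-sum (+ 2) (λ j → val (cell (f i) (f j))))) ⟩
      sum (λ i → sum (λ j → + 2 * val (cell (f i) (f j))))
        ≡⟨ sum-cong-≗ (λ i → sum-cong-≗ (λ j → 2val (cell (f i) (f j)))) ⟩
      sum (λ i → sum (λ j → 1ℤ + Σ₃ (λ k → qval k (cell (f i) (f j)))))
        ≡⟨ sum-cong-≗ (λ i → trans (∑-distrib-+ (const 1ℤ) (λ j → Σ₃ (λ k → qval k (cell (f i) (f j)))))
             (cong₂ _+_ (sum-const N 1ℤ) (sum-Σ₃ (λ k j → qval k (cell (f i) (f j)))))) ⟩
      sum (λ i → + N * 1ℤ + Σ₃ (λ k → Q.lin k f (f i)))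
        ≡⟨ trans (∑-distrib-+ (const (+ N * 1ℤ)) (λ i → Σ₃ (λ k → Q.lin k f (f i))))
             (cong₂ _+_ (sum-const N (+ N * 1ℤ)) (sum-Σ₃ (λ k i → Q.lin k f (f i)))) ⟩
      + N * (+ N * 1ℤ) + Σ₃ (λ k → Q.quad k f)
        ≡⟨ cong (_+ Σ₃ (λ k → Q.quad k f)) (trans (cong (+ N *_) (*-identityʳ (+ N))) N²) ⟩
      + 4 * (W * W) * (s * s) + Σ₃ (λ k → Q.quad k f) ∎
      where
      open ≡-Reasoning
      sum-Σ₃ : ∀ (t : Colour → Vector ℤ N) → sum (λ j → Σ₃ (λ k → t k j)) ≡ Σ₃ (λ k → sum (t k))
      sum-Σ₃ t = trans (∑-distrib-+ (λ j → t 0F j + t 1F j) (t 2F)) (cong (_+ sum (t 2F)) (∑-distrib-+ (t 0F) (t 1F)))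

    S-zero : ∀ f k → threshold ≤ Q.quad k f → S f k ≡ 0ℤ
    S-zero f k T≤Q = pos-part-nonpos (≤-by (gap T≤Q) (lemma threshold (Q.quad k f)))
      where
      lemma : ∀ t q → q - t ≡ 0ℤ - (t - q)
      lemma = solve-∀

    -- L is the Lagrangian of the penalised problem; by local maximality it is constant up to `tolerance`.
    module LocalMaximum (f : Vector V N) (max : ∀ i j → Φ (f [ i ≔ f j ]) ≤ Φ f)
                        (S≤ : ∀ k → S f k ≤ + 2 * (s * s)) (1≤N : 1ℤ ≤ + N) where

      h : Fin N → ℤ
      h i = P.lin f (f i)

      hq : Colour → Fin N → ℤ
      hq k i = Q.lin k f (f i)

      -- Half the derivative of `Φ`. Divided by s² it is h + Σ μ_k h_k with μ_k = 4W²S_k/s², and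
      -- `factor k` below is s²(1 + μ_k).
      L : Fin N → ℤ
      L i = s * s * h i + + 4 * (W * W) * Σ₃ (λ k → S f k * hq k i)

      hq-≤ : ∀ k i → hq k i ≤ + N
      hq-≤ k i = ≤-trans (sum-≤-const (λ j → proj₂ (proj₁ (qval-bounds k (cell (f i) (f j)))))) (≤-reflexive (*-identityʳ (+ N)))

      hq-≥ : ∀ k i → - + N ≤ hq k i
      hq-≥ k i = ≤-trans (≤-reflexive (lemma (+ N))) (const-≤-sum (λ j → proj₁ (proj₁ (qval-bounds k (cell (f i) (f j))))))
        where
        lemma : ∀ n → - n ≡ n * -1ℤ
        lemma = solve-∀

      module Move (i j : Fin N) where
        u v : V
        u = f i
        v = f j
        f′ : Vector V N
        f′ = f [ i ≔ v ]

        εP : ℤ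
        εP = val (cell v v) + val (cell u u) - + 2 * val (cell u v)

        ε : Colour → ℤ
        ε k = qval k (cell v v) + qval k (cell u u) - + 2 * qval k (cell u v)

        diagonal : ∀ (g : Cell → ℤ) → g (cell v v) + g (cell u u) - + 2 * g (cell u v) ≡ g none + g none - + 2 * g (cell u v)
        diagonal g = cong₂ (λ a b → g a + g b - + 2 * g (cell u v)) (cell-irrefl v) (cell-irrefl u)

        εP-≥ : - + 6 ≤ εP
        εP-≥ = subst (- + 6 ≤_) (sym (diagonal val))
          (≤-by (0≤* (0≤+n {2}) (gap (proj₂ (val-bounds (cell u v))))) (lemma (val (cell u v))))
          where
          lemma : ∀ x → + 2 * (+ 2 - x) ≡ -1ℤ + -1ℤ - + 2 * x - - + 6
          lemma = solve-∀

        ε-≥ : ∀ k → - + 4 ≤ ε k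
        ε-≥ k = subst (- + 4 ≤_) (sym (diagonal (qval k)))
          (≤-by (0≤* (0≤+n {2}) (gap (proj₂ (proj₁ (qval-bounds k (cell u v)))))) (lemma (qval k (cell u v))))
          where
          lemma : ∀ x → + 2 * (1ℤ - x) ≡ -1ℤ + -1ℤ - + 2 * x - - + 4
          lemma = solve-∀

        ε-≤ : ∀ k → ε k ≤ 0ℤ
        ε-≤ k = subst (_≤ 0ℤ) (sym (diagonal (qval k)))
          (≤-by (0≤* (0≤+n {2}) (gap (proj₁ (proj₁ (qval-bounds k (cell u v)))))) (lemma (qval k (cell u v))))
          where
          lemma : ∀ x → + 2 * (x - -1ℤ) ≡ 0ℤ - (-1ℤ + -1ℤ - + 2 * x)
          lemma = solve-∀

        d : Colour → ℤ
        d k = hq k j - hq k i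

        d-≤ : ∀ k → d k ≤ + 2 * + N
        d-≤ k = ≤-by (0≤+ (gap (hq-≤ k j)) (gap (hq-≥ k i))) (lemma (+ N) (hq k j) (hq k i))
          where
          lemma : ∀ n a b → n - a + (b - - n) ≡ + 2 * n - (a - b)
          lemma = solve-∀

        d-≥ : ∀ k → - (+ 2 * + N) ≤ d k
        d-≥ k = ≤-by (0≤+ (gap (hq-≤ k i)) (gap (hq-≥ k j))) (lemma (+ N) (hq k j) (hq k i))
          where
          lemma : ∀ n a b → n - b + (a - - n) ≡ a - b - - (+ 2 * n)
          lemma = solve-∀

        S′-sq : ∀ k → S f′ k * S f′ k ≤
                S f k * S f k - + 2 * S f k * (+ 2 * d k + ε k) + (+ 2 * d k + ε k) * (+ 2 * d k + ε k)
        S′-sq k = subst (λ x → pos-part x * pos-part x ≤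
                       S f k * S f k - + 2 * S f k * (+ 2 * d k + ε k) + (+ 2 * d k + ε k) * (+ 2 * d k + ε k))
          (trans (lemma threshold (Q.quad k f) (+ 2 * d k + ε k)) (cong (_-_ threshold) (sym (Q.quad-update k f i v))))
          (pos-part-sq (threshold - Q.quad k f) (+ 2 * d k + ε k))
          where
          lemma : ∀ t q e → t - q - e ≡ t - (q + e)
          lemma = solve-∀

        L-difference : L j - L i ≤ tolerance W s
        L-difference = ≤-trans (≤-reflexive (lemma (s * s) (W * W) (h j) (h i) (S f 0F) (S f 1F) (S f 2F)
            (hq 0F j) (hq 1F j) (hq 2F j) (hq 0F i) (hq 1F i) (hq 2F i)))
          (first-order {s} {W} {P.quad f} {h j - h i} {εP} (S f) (S f′) d 1≤W εP-≥
            (λ k → subst (λ n → + 2 * (W * W) * (S f′ k * S f′ k) + + 8 * (W * W) * (S f k * d k) ≤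
                         + 2 * (W * W) * (S f k * S f k) + (+ 32 * (W * W) * (s * s) + + 128 * (W * W) * (n * n))) N≡2Ws
               (penalty-change {s} {W} {+ N} {S f k} {S f′ k} {d k} {ε k} 1≤N (pos-part-≥0 (threshold - Q.quad k f)) (S≤ k) (S′-sq k) (ε-≥ k) (ε-≤ k) (d-≥ k) (d-≤ k)))
            (subst (λ p → s * s * p - + 2 * (W * W) * penalty f′ ≤ Φ f) (P.quad-update f i v) (max i j)))
          where
          lemma : ∀ s² W² a b S₀ S₁ S₂ a₀ a₁ a₂ b₀ b₁ b₂ →
            s² * a + + 4 * W² * (S₀ * a₀ + S₁ * a₁ + S₂ * a₂) - (s² * b + + 4 * W² * (S₀ * b₀ + S₁ * b₁ + S₂ * b₂)) ≡
            s² * (a - b) + + 4 * W² * (S₀ * (a₀ - b₀) + S₁ * (a₁ - b₁) + S₂ * (a₂ - b₂))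
          lemma = solve-∀

      Λ : ℤ
      Λ = s * s * P.quad f + + 4 * (W * W) * Σ₃ (λ k → S f k * Q.quad k f)

      sum-L : sum L ≡ Λ
      sum-L = begin
        sum L
          ≡⟨ ∑-distrib-+ (λ i → s * s * h i) _ ⟩
        sum (λ i → s * s * h i) + sum (λ i → + 4 * (W * W) * Σ₃ (λ k → S f k * hq k i))
          ≡⟨ cong₂ _+_ (sym (*-distribˡ-sum (s * s) h)) (sym (*-distribˡ-sum (+ 4 * (W * W)) (λ i → Σ₃ (λ k → S f k * hq k i)))) ⟩
        s * s * P.quad f + + 4 * (W * W) * sum (λ i → Σ₃ (λ k → S f k * hq k i))
          ≡⟨ cong (λ x → s * s * P.quad f + + 4 * (W * W) * x)
               (trans (∑-distrib-+ (λ i → S f 0F * hq 0F i + S f 1F * hq 1F i) _)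
               (cong₂ _+_ (trans (∑-distrib-+ (λ i → S f 0F * hq 0F i) _) (cong₂ _+_ (pull 0F) (pull 1F))) (pull 2F))) ⟩
        Λ ∎
        where
        open ≡-Reasoning
        pull : ∀ k → sum (λ i → S f k * hq k i) ≡ S f k * Q.quad k f
        pull k = sym (*-distribˡ-sum (S f k) (hq k))

      -- `Λ` is the sum of all `L j`, so `L-difference` is summed over `j`.
      L-≥ : ∀ i → Λ - + N * tolerance W s ≤ + N * L i
      L-≥ i = ≤-trans (≤-reflexive (sym (trans (∑-distrib-- L (const (tolerance W s))) (cong₂ _-_ sum-L (sum-const N (tolerance W s))))))
        (sum-≤-const (λ j → ≤-by (gap (Move.L-difference i j)) (lemma (tolerance W s) (L j) (L i))))
        where
        lemma : ∀ t a b → t - (a - b) ≡ b - (a - t)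
        lemma = solve-∀

      pair-sum : ∀ (g : Cell → ℤ) i j →
        sum (λ z → g (cell (f i) (f z))) + sum (λ z → g (cell (f j) (f z))) ≡
        sum (λ z → g (cell (f z) (f i)) + g (cell (f z) (f j)))
      pair-sum g i j = trans
        (cong₂ _+_ (sum-cong-≗ (λ z → cong g (cell-sym (f i) (f z)))) (sum-cong-≗ (λ z → cong g (cell-sym (f j) (f z)))))
        (sym (∑-distrib-+ (λ z → g (cell (f z) (f i))) (λ z → g (cell (f z) (f j)))))

      pair-≤ : ∀ (g : Cell → ℤ) {c} i j → (∀ z → g (cell (f z) (f i)) + g (cell (f z) (f j)) ≤ c) →
        sum (λ z → g (cell (f i) (f z))) + sum (λ z → g (cell (f j) (f z))) ≤ + N * c
      pair-≤ g i j ≤c = ≤-trans (≤-reflexive (pair-sum g i j)) (sum-≤-const ≤c)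

      L-pair : ∀ i j → L i + L j ≡ s * s * (h i + h j) + + 4 * (W * W) * Σ₃ (λ k → S f k * (hq k i + hq k j))
      L-pair i j = lemma (s * s) (W * W) (h i) (h j) (S f 0F) (S f 1F) (S f 2F)
        (hq 0F i) (hq 1F i) (hq 2F i) (hq 0F j) (hq 1F j) (hq 2F j)
        where
        lemma : ∀ s² W² a b S₀ S₁ S₂ a₀ a₁ a₂ b₀ b₁ b₂ →
          s² * a + + 4 * W² * (S₀ * a₀ + S₁ * a₁ + S₂ * a₂) + (s² * b + + 4 * W² * (S₀ * b₀ + S₁ * b₁ + S₂ * b₂)) ≡
          s² * (a + b) + + 4 * W² * (S₀ * (a₀ + b₀) + S₁ * (a₁ + b₁) + S₂ * (a₂ + b₂))
        lemma = solve-∀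

      m : ℤ
      m = Λ - + N * tolerance W s

      2m≤ : ∀ {x} i j → L i + L j ≤ x → + 2 * m ≤ + N * x
      2m≤ {x} i j ≤x = ≤-by
        (0≤+ (0≤+ (gap (L-≥ i)) (gap (L-≥ j))) (0≤* (0≤≥1 1≤N) (gap ≤x)))
        (lemma (+ N) m (L i) (L j) x)
        where
        lemma : ∀ n m a b x → n * a - m + (n * b - m) + n * (x - (a + b)) ≡ n * x - + 2 * m
        lemma = solve-∀

      S≥0 : ∀ k → 0ℤ ≤ S f k
      S≥0 k = pos-part-≥0 (threshold - Q.quad k f)

      module Contradiction
        (P≥ : + 4 * (W * W) * (s * s) + + 12 * (s * s) * Z ≤ + 2 * P.quad f)
        (Q≥ : ∀ k → + 4 * (s * s) * (Θ * Θ) ≤ Q.quad k f) where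

        𝒯f : Template (Fin N)
        𝒯f = pullback f 𝒯

        C : Fin N → Fin N → Cell
        C = Template.cell 𝒯f

        Q≥0 : ∀ k → 0ℤ ≤ Q.quad k f
        Q≥0 k = ≤-trans (0≤* (0≤* (0≤+n {4}) (0≤² s)) (0≤² Θ)) (Q≥ k)

        -- In densities the hypothesis says 2Λ ≤ 1 up to the tolerance, whereas Λ ≥ P, as all μ_k
        -- and Q_k are nonnegative, and 2P ≥ 1 + 3y.
        full-absurd : + 2 * m ≤ + N * (s * s * + N) → ⊥
        full-absurd 2m≤N² = neg-absurd
          (0≤+ (0≤+ (0≤+ (0≤+ (0≤+ (gap 2m≤′) (0≤* (0≤+n {2}) (gap P≤Λ))) (0≤* (0≤² s) (gap P≥)))
            (0≤* (0≤* (0≤+n {12}) (0≤* (0≤² s) (0≤² s))) (0≤+ (gap 1≤R) (0≤² Θ))))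
            (0≤* (0≤* (0≤+n {12}) (0≤≥1 1≤sss)) (gap s-large)))
            (0≤* (0≤+n {8}) (gap (1≤* {+ 1000} (+≤+ (ℕ.s≤s ℕ.z≤n)) (1≤* (1≤* (1≤* (1≤* 1≤W 1≤W) (1≤* 1≤W 1≤W)) 1≤W) 1≤sss)))))
          (lemma (+ 1000) s W Θ R (P.quad f) Λ)
          where
          1≤sss : 1ℤ ≤ s * s * s
          1≤sss = 1≤* (1≤* 1≤s 1≤s) 1≤s
          P≤Λ : s * s * P.quad f ≤ Λ
          P≤Λ = ≤-by (0≤* (0≤* (0≤+n {4}) (0≤² W))
              (0≤+ (0≤+ (0≤* (S≥0 0F) (Q≥0 0F)) (0≤* (S≥0 1F) (Q≥0 1F))) (0≤* (S≥0 2F) (Q≥0 2F))))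
            (cancel (s * s * P.quad f) (+ 4 * (W * W) * Σ₃ (λ k → S f k * Q.quad k f)))
            where
            cancel : ∀ a b → b ≡ a + b - a
            cancel = solve-∀
          square : ∀ s W → + 2 * W * s * (s * s * (+ 2 * W * s)) ≡ s * s * (+ 4 * (W * W) * (s * s))
          square = solve-∀
          2m≤′ : + 2 * (Λ - + 2 * W * s * tolerance W s) ≤ s * s * (+ 4 * (W * W) * (s * s))
          2m≤′ = subst (+ 2 * (Λ - + 2 * W * s * tolerance W s) ≤_) (square s W)
            (subst (λ n → + 2 * (Λ - n * tolerance W s) ≤ n * (s * s * n)) N≡2Ws 2m≤N²)
          lemma : ∀ K s W Θ R P Λ →
            s * s * (+ 4 * (W * W) * (s * s)) - + 2 * (Λ - + 2 * W * s * (K * (W * W * (W * W)) * (s * s)))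
            + + 2 * (Λ - s * s * P)
            + s * s * (+ 2 * P - (+ 4 * (W * W) * (s * s) + + 12 * (s * s) * (R + Θ * Θ)))
            + + 12 * (s * s * (s * s)) * (R - 1ℤ + Θ * Θ)
            + + 12 * (s * s * s) * (s - K * (W * W * (W * W) * W))
            + + 8 * (K * (W * W * (W * W) * W * (s * s * s)) - 1ℤ) ≡ - + 8
          lemma = solve-∀

        no-full : ∀ i j → C i j ≢ full
        no-full i j ij = full-absurd (2m≤ i j (≤-trans (≤-reflexive (L-pair i j)) (≤-by
          (0≤+ (0≤* (0≤² s) (gap h≤)) (0≤* (0≤* (0≤+n {4}) (0≤² W))
            (0≤+ (0≤+ (0≤* (S≥0 0F) (gap (hq≤0 0F))) (0≤* (S≥0 1F) (gap (hq≤0 1F)))) (0≤* (S≥0 2F) (gap (hq≤0 2F))))))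
          (lemma (s * s) (W * W) (+ N) (h i + h j) (S f 0F) (S f 1F) (S f 2F)
            (hq 0F i + hq 0F j) (hq 1F i + hq 1F j) (hq 2F i + hq 2F j)))))
          where
          cells : ∀ z → val (C z i) + val (C z j) ≤ 1ℤ × (∀ l → qval l (C z i) + qval l (C z j) ≤ 0ℤ)
          cells z = cells-across-full (C z i) (C z j) λ k →
            compat 𝒯f k (λ m _ → subst (λ c → T (has c m)) (sym ij) _) z
          h≤ : h i + h j ≤ + N
          h≤ = ≤-trans (pair-≤ val i j (proj₁ ∘ cells)) (≤-reflexive (*-identityʳ (+ N)))
          hq≤0 : ∀ k → hq k i + hq k j ≤ 0ℤ
          hq≤0 k = ≤-trans (pair-≤ (qval k) i j (λ z → proj₂ (cells z) k)) (≤-reflexive (*-zeroʳ (+ N)))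
          lemma : ∀ s² W² N g S₀ S₁ S₂ a b c →
            s² * (N - g) + + 4 * W² * (S₀ * (0ℤ - a) + S₁ * (0ℤ - b) + S₂ * (0ℤ - c)) ≡
            s² * N - (s² * g + + 4 * W² * (S₀ * a + S₁ * b + S₂ * c))
          lemma = solve-∀

        open Configuration 𝒯f no-full

        -- Across a pair of kind `p` the multipliers of the other colours contribute at most 0 by
        -- `qval-across-edge`, and for `p` itself `hq p` is bounded by `h`; this leaves h(i) + h(j)
        -- times a single factor.
        edge-≤ : ∀ {p i j} → Edge p i j →
                 + 2 * m ≤ (s * s + + 4 * (W * W) * S f p) * (+ N * (h i + h j))
        edge-≤ {p} {i} {j} e = ≤-trans (2m≤ i j (≤-trans (≤-reflexive (L-pair i j)) (≤-by
          (0≤* (0≤* (0≤+n {4}) (0≤² W)) (0≤+ (gap (Σ₃-≤-term {t} p t≤0)) (0≤* (S≥0 p) (gap hq≤h))))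
          (lemma (s * s) (W * W) (h i + h j) (S f p) (Σ₃ t) (hq p i + hq p j)))))
          (≤-reflexive (swap-factors (+ N) (s * s + + 4 * (W * W) * S f p) (h i + h j)))
          where
          t : Colour → ℤ
          t k = S f k * (hq k i + hq k j)
          hq≤h : hq p i + hq p j ≤ h i + h j
          hq≤h = +-mono-≤ (sum-mono λ z → proj₂ (qval-bounds p (cell (f i) (f z))))
                          (sum-mono λ z → proj₂ (qval-bounds p (cell (f j) (f z))))
          t≤0 : ∀ k → k ≢ p → t k ≤ 0ℤ
          t≤0 k k≢p = ≤-by (0≤* (S≥0 k) (gap (≤-trans
              (pair-≤ (qval k) i j λ z → qval-across-edge p k k≢p _ (no-full z i) _ (no-full z j) (compat-two 𝒯f e z))
              (≤-reflexive (*-zeroʳ (+ N))))))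
            (negate (S f k) (hq k i + hq k j))
            where
            negate : ∀ a b → a * (0ℤ - b) ≡ 0ℤ - a * b
            negate = solve-∀
          lemma : ∀ s² W² g S Σ q → + 4 * W² * (S * q - Σ + S * (g - q)) ≡ (s² + + 4 * W² * S) * g - (s² * g + + 4 * W² * Σ)
          lemma = solve-∀
          swap-factors : ∀ n x g → n * (x * g) ≡ x * (n * g)
          swap-factors = solve-∀

        -- Q_k > 0 needs a cell where `qval k` is positive, and with `full` excluded that is
        -- `two k`.
        edge-exists : ∀ k → ∃[ i ] ∃[ j ] Edge k i j
        edge-exists k =
          let i , 0<hq = sum>0⇒∃>0 (hq k) (<-≤-trans 0<Θ (Q≥ k))
              j , 0<q  = sum>0⇒∃>0 (λ j → qval k (C i j)) 0<hq
          in  i , j , qval>0⇒two k (C i j) (no-full i j) 0<q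
          where
          0<Θ : 0ℤ < + 4 * (s * s) * (Θ * Θ)
          0<Θ = suc[i]≤j⇒i<j (1≤* (1≤* {+ 4} (+≤+ (ℕ.s≤s ℕ.z≤n)) (1≤* 1≤s 1≤s)) (1≤* 1≤Θ 1≤Θ))

        all-penalised : Q.quad 0F f < threshold → Q.quad 1F f < threshold → Q.quad 2F f < threshold → ⊥
        all-penalised a b c = neg-absurd
          (0≤+ (0≤+ (0≤+ (0≤+ (gap (≤-trans P≥ (≤-reflexive (2P f)))) (gap-< a)) (gap-< b)) (gap-< c))
               (0≤* (0≤* (0≤+n {6}) (0≤² s)) (0≤≥1 1≤R)))
          (lemma s W R Z (Q.quad 0F f) (Q.quad 1F f) (Q.quad 2F f))
          where
          lemma : ∀ s W R Z q₀ q₁ q₂ →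
            + 4 * (W * W) * (s * s) + (q₀ + q₁ + q₂) - (+ 4 * (W * W) * (s * s) + + 12 * (s * s) * Z)
            + (+ 4 * (s * s) * Z - + 2 * (s * s) * R - q₀ - 1ℤ)
            + (+ 4 * (s * s) * Z - + 2 * (s * s) * R - q₁ - 1ℤ)
            + (+ 4 * (s * s) * Z - + 2 * (s * s) * R - q₂ - 1ℤ)
            + + 6 * (s * s) * R ≡ - + 3
          lemma = solve-∀

        unpenalised : ∃[ k ] S f k ≡ 0ℤ
        unpenalised = by-cases (threshold ≤? Q.quad 0F f) (threshold ≤? Q.quad 1F f) (threshold ≤? Q.quad 2F f)
          where
          by-cases : Dec (threshold ≤ Q.quad 0F f) → Dec (threshold ≤ Q.quad 1F f) → Dec (threshold ≤ Q.quad 2F f) →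
                     ∃[ k ] S f k ≡ 0ℤ
          by-cases (yes T≤Q) _ _ = 0F , S-zero f 0F T≤Q
          by-cases (no _) (yes T≤Q) _ = 1F , S-zero f 1F T≤Q
          by-cases (no _) (no _) (yes T≤Q) = 2F , S-zero f 2F T≤Q
          by-cases (no a) (no b) (no c) = ⊥-elim (all-penalised (≰⇒> a) (≰⇒> b) (≰⇒> c))

        factor : Colour → ℤ
        factor k = s * s + + 4 * (W * W) * S f k

        factor-≥1 : ∀ k → 1ℤ ≤ factor k
        factor-≥1 k = ≤-by (0≤+ (gap (1≤* 1≤s 1≤s)) (0≤* (0≤* (0≤+n {4}) (0≤² W)) (S≥0 k)))
          (lemma (s * s) (+ 4 * (W * W) * S f k))
          where
          lemma : ∀ a b → a - 1ℤ + b ≡ a + b - 1ℤ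
          lemma = solve-∀

        -- Here μ_p = 0, so `p` supplies the entry s² of `no-balance`. Cauchy-Schwarz is applied
        -- with W - 2Θ, Θ, Θ for `p`, `q`, `r`, which add up to W.
        conclude : ∀ {p q r} → Distinct p q r → S f p ≡ 0ℤ → ∀ {g₁ g₂ g₃} →
          + 2 * m ≤ factor p * (+ N * g₁) → + 2 * m ≤ factor q * (+ N * g₂) → + 2 * m ≤ factor r * (+ N * g₃) →
          g₁ + g₂ + g₃ ≤ + 2 * + N → ⊥
        conclude {p} {q} {r} d Sp≡0 {g₁} {g₂} {g₃} e₁ e₂ e₃ g≤ =
          no-balance {W * W} {s * s} {factor q} {factor r} {M} {m} {+ N * g₁} {+ N * g₂} {+ N * g₃}
            (0≤² s) (factor-≥1 q) (factor-≥1 r)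
            (subst (_≤ M * (factor q * factor r + s * s * (factor q + factor r)))
              (collapse W Θ (s * s) (factor q * factor r))
              (cauchy (W - Θ - Θ) Θ s (factor q) (factor r) (0≤≥1 (factor-≥1 q)) (0≤≥1 (factor-≥1 r))))
            (subst (+ 4 * (s * s) * M <_) m≡
              (lagrangian-large {s} {W} {Θ} {R} {P.quad f} {Q.quad q f} {Q.quad r f} {S f q} {S f r}
                1≤W 1≤R 1≤s s-large θ-eq P≥ (S≥0 q) (S≥0 r) (Q≥ q) (Q≥ r)))
            (subst (λ x → + 2 * m ≤ x * (+ N * g₁)) factor-p e₁) e₂ e₃
            (≤-by (0≤* (0≤≥1 1≤N) (gap g≤)) (trans (regroup (+ N) g₁ g₂ g₃)
              (cong (_- (+ N * g₁ + + N * g₂ + + N * g₃)) (trans (cong (+ 2 *_) N²) (double (W * W) (s * s))))))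
          where
          M = (W - Θ - Θ) * (W - Θ - Θ) * (s * s) + Θ * Θ * (factor q + factor r)
          collapse : ∀ W Θ s² XY → (W - Θ - Θ + Θ + Θ) * (W - Θ - Θ + Θ + Θ) * s² * XY ≡ W * W * s² * XY
          collapse = solve-∀
          drop-zero : ∀ a b → a + b * 0ℤ ≡ a
          drop-zero = solve-∀
          factor-p : factor p ≡ s * s
          factor-p = trans (cong (λ x → s * s + + 4 * (W * W) * x) Sp≡0) (drop-zero (s * s) (+ 4 * (W * W)))
          regroup : ∀ n a b c → n * (+ 2 * n - (a + b + c)) ≡ + 2 * (n * n) - (n * a + n * b + n * c)
          regroup = solve-∀
          double : ∀ a b → + 2 * (+ 4 * a * b) ≡ + 8 * a * b
          double = solve-∀
          zero-left : ∀ a b c → 0ℤ * a + b + c ≡ b + c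
          zero-left = solve-∀
          m≡ : s * s * P.quad f + + 4 * (W * W) * (S f q * Q.quad q f + S f r * Q.quad r f)
                 - + 2 * W * s * tolerance W s ≡ m
          m≡ = cong₂ (λ x n → s * s * P.quad f + + 4 * (W * W) * x - n * tolerance W s)
            (sym (trans (Σ₃-permute d (λ k → S f k * Q.quad k f))
              (trans (cong (λ x → x * Q.quad p f + S f q * Q.quad q f + S f r * Q.quad r f) Sp≡0)
                     (zero-left (Q.quad p f) (S f q * Q.quad q f) (S f r * Q.quad r f)))))
            (sym N≡2Ws)

        absurd : ⊥
        absurd =
          let _ , _ , e₀ = edge-exists 0F
              _ , _ , e₁ = edge-exists 1F
              _ , _ , e₂ = edge-exists 2F
          in  from-balanced (balanced ((λ ()) , (λ ()) , (λ ())) e₀ e₁ e₂) unpenalised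
          where
          from-balanced : Balanced → ∃[ k ] S f k ≡ 0ℤ → ⊥
          from-balanced b (k , Sk≡0) = [ (λ k≡p → conclude distinct (trans (sym (cong (S f) k≡p)) Sk≡0) p≤ q≤ r≤ g≤)
            , [ (λ k≡q → conclude (rotate distinct) (trans (sym (cong (S f) k≡q)) Sk≡0) q≤ r≤ p≤
                           (subst (_≤ + 2 * + N) (cycle g₁ g₂ g₃) g≤))
              , (λ k≡r → conclude (rotate (rotate distinct)) (trans (sym (cong (S f) k≡r)) Sk≡0) r≤ p≤ q≤
                           (subst (_≤ + 2 * + N) (trans (cycle g₁ g₂ g₃) (cycle g₂ g₃ g₁)) g≤)) ]′ ]′
            (is-one-of p q r distinct k)
            where
            open Balanced b
            g₁ = h u + h u′
            g₂ = h v + h v′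
            g₃ = h w + h w′
            p≤ = edge-≤ p-edge
            q≤ = edge-≤ q-edge
            r≤ = edge-≤ r-edge
            cycle : ∀ a b c → a + b + c ≡ b + c + a
            cycle = solve-∀
            g≤ : g₁ + g₂ + g₃ ≤ + 2 * + N
            g≤ = ≤-trans (≤-reflexive (trans
                (cong₂ _+_ (cong₂ _+_ (pair-sum val u u′) (pair-sum val v v′)) (pair-sum val w w′))
                (sym (trans (∑-distrib-+ (λ z → weight u u′ z + weight v v′ z) (weight w w′))
                  (cong (_+ sum (weight w w′)) (∑-distrib-+ (weight u u′) (weight v v′)))))))
              (≤-trans (sum-≤-const balance) (≤-reflexive (*-comm (+ N) (+ 2))))

  -- The start `f₀` pays no penalty, so `Φ f₀` is s² times its P. A local maximum reached from it
  -- therefore has P at least as large and a bounded penalty, which gives both hypotheses of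
  -- `Contradiction`.
  no-dense-template : ∀ {V : Set} (𝒯 : Template V) {N} (scale : Scale N) (f₀ : Vector V N) →
    ¬ (∀ k → + 4 * (Scale.s scale * Scale.s scale) * Penalised.Z 𝒯 scale ≤ Penalised.Q.quad 𝒯 scale k f₀)
  no-dense-template {V} 𝒯 {N} scale f₀ Q₀≥ =
    let f , Φ₀≤Φ , max = local-max Φ _ Φ-bound f₀ in At.absurd f Φ₀≤Φ max
    where
    open Penalised 𝒯 scale
    open Scale scale

    T≤Z : threshold ≤ + 4 * (s * s) * Z
    T≤Z = ≤-by (0≤* (0≤* (0≤+n {2}) (0≤² s)) (0≤≥1 1≤R)) (lemma (+ 4 * (s * s) * Z) (+ 2 * (s * s) * R))
      where
      lemma : ∀ a b → b ≡ a - (a - b)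
      lemma = solve-∀

    penalty₀ : penalty f₀ ≡ 0ℤ
    penalty₀ = cong₂ _+_ (cong₂ _+_ (zero² 0F) (zero² 1F)) (zero² 2F)
      where
      zero² : ∀ k → S f₀ k * S f₀ k ≡ 0ℤ
      zero² k = cong₂ _*_ (S-zero f₀ k (≤-trans T≤Z (Q₀≥ k))) (S-zero f₀ k (≤-trans T≤Z (Q₀≥ k)))

    P₀≥ : + 4 * (W * W) * (s * s) + + 12 * (s * s) * Z ≤ + 2 * P.quad f₀
    P₀≥ = ≤-trans (≤-by (0≤+ (0≤+ (gap (Q₀≥ 0F)) (gap (Q₀≥ 1F))) (gap (Q₀≥ 2F)))
        (lemma (+ 4 * (W * W) * (s * s)) (s * s) Z (Q.quad 0F f₀) (Q.quad 1F f₀) (Q.quad 2F f₀)))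
      (≤-reflexive (sym (2P f₀)))
      where
      lemma : ∀ n s² z a b c → a - + 4 * s² * z + (b - + 4 * s² * z) + (c - + 4 * s² * z) ≡
                               n + (a + b + c) - (n + + 12 * s² * z)
      lemma = solve-∀

    0≤P₀ : 0ℤ ≤ P.quad f₀
    0≤P₀ = cancel-≤ (+ 2) (+≤+ (ℕ.s≤s ℕ.z≤n)) (≤-trans
      (0≤+ (0≤* (0≤* (0≤+n {4}) (0≤² W)) (0≤² s)) (0≤* (0≤* (0≤+n {12}) (0≤² s)) (0≤+ (0≤≥1 1≤R) (0≤² Θ)))) P₀≥)

    1≤N : 1ℤ ≤ + N
    1≤N = subst (1ℤ ≤_) (sym N≡2Ws) (1≤* (1≤* {+ 2} (+≤+ (ℕ.s≤s ℕ.z≤n)) 1≤W) 1≤s)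

    module At (f : Vector V N) (Φ₀≤Φ : Φ f₀ ≤ Φ f) (max : ∀ i j → Φ (f [ i ≔ f j ]) ≤ Φ f) where

      Φ≥ : s * s * P.quad f₀ ≤ s * s * P.quad f - + 2 * (W * W) * penalty f
      Φ≥ = subst (_≤ Φ f) (trans (cong (λ x → s * s * P.quad f₀ - + 2 * (W * W) * x) penalty₀)
                                 (lemma (s * s * P.quad f₀) (+ 2 * (W * W)))) Φ₀≤Φ
        where
        lemma : ∀ a b → a - b * 0ℤ ≡ a
        lemma = solve-∀

      S≤ : ∀ k → S f k ≤ + 2 * (s * s)
      S≤ k = bounded-penalty {s} {W} {P.quad f} {P.quad f₀} {penalty f} 1≤s 1≤W 0≤P₀
        (Σ₃-≥-term {λ k → S f k * S f k} (λ k → 0≤² (S f k)) k) Φ≥ (P-bound f)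

      Q≥ : ∀ k → + 4 * (s * s) * (Θ * Θ) ≤ Q.quad k f
      Q≥ k = ≤-by
        (0≤+ (0≤+ (gap (S≤ k)) (gap (pos-part-≥ (threshold - Q.quad k f)))) (0≤* (0≤* (0≤+n {2}) (0≤² s)) (gap 1≤R)))
        (lemma s R Θ (Q.quad k f) (S f k))
        where
        lemma : ∀ s R Θ q S →
          + 2 * (s * s) - S + (S - (+ 4 * (s * s) * (R + Θ * Θ) - + 2 * (s * s) * R - q)) + + 2 * (s * s) * (R - 1ℤ) ≡
          q - + 4 * (s * s) * (Θ * Θ)
        lemma = solve-∀

      P≥ : + 4 * (W * W) * (s * s) + + 12 * (s * s) * Z ≤ + 2 * P.quad f
      P≥ = ≤-trans P₀≥ (*-monoˡ-≤-nonNeg (+ 2) (penalised-≤ {s} {W} {P.quad f} {P.quad f₀} 1≤s (penalty-≥0 f) Φ≥))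

      absurd : ⊥
      absurd = LocalMaximum.Contradiction.absurd f max S≤ 1≤N P≥ Q≥

-- From graphs to templates: edge counts, blow-up and the choice of scale.

module Counting where

  open Integers
  open LocalSearch
  open Cells
  open Penalty
  open import Defs using (Graph; Adj; ∣E_∣)
  open import Data.Integer.Base hiding (suc; pred)
  open import Data.Integer.Properties hiding (_≟_)
  open import Data.Integer.Tactic.RingSolver using (solve-∀)
  open import Algebra.Properties.Semiring.Sum +-*-semiring
    using (sum; sum-cong-≗; ∑-distrib-+; ∑-comm; *-distribˡ-sum)

  cell-of : Bool → Bool → Bool → Cell
  cell-of false false false = none
  cell-of true  false false = one 0F
  cell-of false true  false = one 1F
  cell-of false false true  = one 2F
  cell-of false true  true  = two 0F
  cell-of true  false true  = two 1F
  cell-of true  true  false = two 2F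
  cell-of true  true  true  = full

  choose : ∀ {a} {A : Set a} → A → A → A → Colour → A
  choose a b c 0F = a
  choose a b c 1F = b
  choose a b c 2F = c

  has-cell-of : ∀ a b c k → has (cell-of a b c) k ≡ choose a b c k
  has-cell-of false false false 0F = refl
  has-cell-of false false false 1F = refl
  has-cell-of false false false 2F = refl
  has-cell-of true  false false 0F = refl
  has-cell-of true  false false 1F = refl
  has-cell-of true  false false 2F = refl
  has-cell-of false true  false 0F = refl
  has-cell-of false true  false 1F = refl
  has-cell-of false true  false 2F = refl
  has-cell-of false false true  0F = refl
  has-cell-of false false true  1F = refl
  has-cell-of false false true  2F = refl
  has-cell-of false true  true  0F = refl
  has-cell-of false true  true  1F = refl
  has-cell-of false true  true  2F = refl
  has-cell-of true  false true  0F = refl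
  has-cell-of true  false true  1F = refl
  has-cell-of true  false true  2F = refl
  has-cell-of true  true  false 0F = refl
  has-cell-of true  true  false 1F = refl
  has-cell-of true  true  false 2F = refl
  has-cell-of true  true  true  0F = refl
  has-cell-of true  true  true  1F = refl
  has-cell-of true  true  true  2F = refl

  qval-indicators : ∀ k c → qval k c ≡
    indicator (has c 0F) + indicator (has c 1F) + indicator (has c 2F) - 1ℤ - indicator (has c k)
  qval-indicators k none    = refl
  qval-indicators k full    = refl
  qval-indicators k (one 0F) = refl
  qval-indicators k (one 1F) = refl
  qval-indicators k (one 2F) = refl
  qval-indicators k (two 0F) = refl
  qval-indicators k (two 1F) = refl
  qval-indicators k (two 2F) = refl

  from-does : ∀ {A : Set} (A? : Dec A) → T (does A?) → A
  from-does (yes a) _ = a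

  module FromGraphs {n : ℕ} (G : Colour → Graph n)
    (no-rainbow : ∀ u v w → Adj (G 0F) u v → Adj (G 1F) v w → Adj (G 2F) w u → ⊥) where

    adj : Colour → Fin n → Fin n → Bool
    adj k u v = does (Graph.adj? (G k) u v)

    adj-sym : ∀ k u v → adj k u v ≡ adj k v u
    adj-sym k u v = does-⇔ (mk⇔ (Graph.sym (G k)) (Graph.sym (G k))) (Graph.adj? (G k) u v) (Graph.adj? (G k) v u)

    adj-irrefl : ∀ k v → adj k v v ≡ false
    adj-irrefl k v = dec-false (Graph.adj? (G k) v v) (Graph.irrefl (G k) refl)

    cell : Fin n → Fin n → Cell
    cell u v = cell-of (adj 0F u v) (adj 1F u v) (adj 2F u v)

    has-cell : ∀ u v k → has (cell u v) k ≡ adj k u v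
    has-cell u v 0F = has-cell-of (adj 0F u v) (adj 1F u v) (adj 2F u v) 0F
    has-cell u v 1F = has-cell-of (adj 0F u v) (adj 1F u v) (adj 2F u v) 1F
    has-cell u v 2F = has-cell-of (adj 0F u v) (adj 1F u v) (adj 2F u v) 2F

    adjacent : ∀ u v k → T (has (cell u v) k) → Adj (G k) u v
    adjacent u v k h = from-does (Graph.adj? (G k) u v) (subst T (has-cell u v k) h)

    template : Template (Fin n)
    template = record
      { cell = cell
      ; cell-sym = λ u v → trans (cong₂ (λ a b → cell-of a b (adj 2F u v)) (adj-sym 0F u v) (adj-sym 1F u v))
                                 (cong (cell-of (adj 0F v u) (adj 1F v u)) (adj-sym 2F u v))
      ; cell-irrefl = λ v → trans (cong₂ (λ a b → cell-of a b (adj 2F v v)) (adj-irrefl 0F v) (adj-irrefl 1F v))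
                                  (cong (cell-of false false) (adj-irrefl 2F v))
      ; rainbow-free = λ {i} {j} {k} d u v w (uv , vw , wu) →
          rainbow-free (permutations i j k d) (adjacent u v i uv) (adjacent v w j vw) (adjacent w u k wu)
      }
      where
      rev : ∀ k {u v} → Adj (G k) u v → Adj (G k) v u
      rev k = Graph.sym (G k)
      -- Even permutations only change the starting vertex of the triangle; odd ones also reverse
      -- its direction.
      rainbow-free : ∀ {i j k u v w} → _ → Adj (G i) u v → Adj (G j) v w → Adj (G k) w u → ⊥
      rainbow-free (inj₁ (refl , refl , refl)) uv vw wu = no-rainbow _ _ _ uv vw wu
      rainbow-free (inj₂ (inj₁ (refl , refl , refl))) uv vw wu = no-rainbow _ _ _ (rev 0F uv) (rev 1F wu) (rev 2F vw)
      rainbow-free (inj₂ (inj₂ (inj₁ (refl , refl , refl)))) uv vw wu = no-rainbow _ _ _ (rev 0F vw) (rev 1F uv) (rev 2F wu)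
      rainbow-free (inj₂ (inj₂ (inj₂ (inj₁ (refl , refl , refl))))) uv vw wu = no-rainbow _ _ _ wu uv vw
      rainbow-free (inj₂ (inj₂ (inj₂ (inj₂ (inj₁ (refl , refl , refl)))))) uv vw wu = no-rainbow _ _ _ vw wu uv
      rainbow-free (inj₂ (inj₂ (inj₂ (inj₂ (inj₂ (refl , refl , refl)))))) uv vw wu = no-rainbow _ _ _ (rev 0F wu) (rev 1F vw) (rev 2F uv)

  length-filter-tabulate : ∀ {A B : Set} {P : Pred B 0ℓ} (P? : Decidable P) (g : A → B) {n} (h : Fin n → A) →
    + length (filter P? (List.map g (List.tabulate h))) ≡ sum (λ j → indicator (does (P? (g (h j)))))
  length-filter-tabulate P? g {zero}  h = refl
  length-filter-tabulate P? g {suc n} h with P? (g (h zero))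
  ... | yes _ = cong (_+_ 1ℤ) (length-filter-tabulate P? g (h ∘ suc))
  ... | no  _ = trans (length-filter-tabulate P? g (h ∘ suc)) (sym (+-identityˡ _))

  length-filter-product : ∀ {A B : Set} {P : Pred (A × B) 0ℓ} (P? : Decidable P) {m n} (g : Fin m → A) (h : Fin n → B) →
    + length (filter P? (cartesianProduct (List.tabulate g) (List.tabulate h))) ≡
    sum (λ i → sum (λ j → indicator (does (P? (g i , h j)))))
  length-filter-product P? {zero}  g h = refl
  length-filter-product P? {suc m} g h = begin
    + length (filter P? (List.map (g zero ,_) (List.tabulate h) ++ rest))
      ≡⟨ cong (+_ ∘ length) (List.filter-++ P? (List.map (g zero ,_) (List.tabulate h)) rest) ⟩
    + length (filter P? (List.map (g zero ,_) (List.tabulate h)) ++ filter P? rest)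
      ≡⟨ cong +_ (List.length-++ (filter P? (List.map (g zero ,_) (List.tabulate h)))) ⟩
    + length (filter P? (List.map (g zero ,_) (List.tabulate h))) + + length (filter P? rest)
      ≡⟨ cong₂ _+_ (length-filter-tabulate P? (g zero ,_) h) (length-filter-product P? (g ∘ suc) h) ⟩
    sum (λ i → sum (λ j → indicator (does (P? (g i , h j))))) ∎
    where
    open ≡-Reasoning
    rest = cartesianProduct (List.tabulate (g ∘ suc)) (List.tabulate h)

  -- Each edge is increasing in exactly one of its two orientations, and `edges` lists the
  -- increasing ones.
  double-count : ∀ {n} (G : Graph n) →
    sum (λ u → sum (λ v → indicator (does (Graph.adj? G u v)))) ≡ + 2 * + ∣E G ∣
  double-count {n} G = begin
    sum (λ u → sum (λ v → a u v))
      ≡⟨ sum-cong-≗ (λ u → trans (sum-cong-≗ (split u)) (∑-distrib-+ (λ v → ordered u v) (λ v → ordered v u))) ⟩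
    sum (λ u → sum (λ v → ordered u v) + sum (λ v → ordered v u))
      ≡⟨ ∑-distrib-+ (λ u → sum (λ v → ordered u v)) (λ u → sum (λ v → ordered v u)) ⟩
    sum (λ u → sum (λ v → ordered u v)) + sum (λ u → sum (λ v → ordered v u))
      ≡⟨ cong (_+_ (sum (λ u → sum (λ v → ordered u v)))) (∑-comm (λ u v → ordered v u)) ⟩
    sum (λ u → sum (λ v → ordered u v)) + sum (λ u → sum (λ v → ordered u v))
      ≡⟨ cong (λ x → x + x) (length-filter-product (λ (u , v) → (u Fin.<? v) ×-dec Graph.adj? G u v) id id) ⟨
    + ∣E G ∣ + + ∣E G ∣
      ≡⟨ double (+ ∣E G ∣) ⟩
    + 2 * + ∣E G ∣ ∎
    where
    open ≡-Reasoning
    double : ∀ x → x + x ≡ + 2 * x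
    double = solve-∀
    a ordered : Fin n → Fin n → ℤ
    a u v = indicator (does (Graph.adj? G u v))
    ordered u v = indicator (does ((u Fin.<? v) ×-dec Graph.adj? G u v))
    ordered-< : ∀ {u v} → u Fin.< v → ordered u v ≡ a u v
    ordered-< {u} {v} u<v rewrite dec-true (u Fin.<? v) u<v = refl
    ordered-≮ : ∀ {u v} → ¬ (u Fin.< v) → ordered u v ≡ 0ℤ
    ordered-≮ {u} {v} u≮v rewrite dec-false (u Fin.<? v) u≮v = refl
    a-sym : ∀ u v → a u v ≡ a v u
    a-sym u v = cong indicator (does-⇔ (mk⇔ (Graph.sym G) (Graph.sym G)) (Graph.adj? G u v) (Graph.adj? G v u))
    split : ∀ u v → a u v ≡ ordered u v + ordered v u
    split u v with Fin.<-cmp u v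
    ... | tri< u<v _ v≮u = sym (trans (cong₂ _+_ (ordered-< u<v) (ordered-≮ v≮u)) (+-identityʳ (a u v)))
    ... | tri> u≮v _ v<u = sym (trans (cong₂ _+_ (ordered-≮ u≮v) (ordered-< v<u)) (trans (+-identityˡ (a v u)) (a-sym v u)))
    ... | tri≈ u≮v u≡v v≮u = trans (cong indicator (dec-false (Graph.adj? G u v) (Graph.irrefl G u≡v)))
                                   (sym (cong₂ _+_ (ordered-≮ u≮v) (ordered-≮ v≮u)))

  sum-↑ : ∀ {m n} (t : Vector ℤ (m ℕ.+ n)) → sum t ≡ sum (t ∘ (_↑ˡ n)) + sum (t ∘ (m ↑ʳ_))
  sum-↑ {zero}  t = sym (+-identityˡ (sum t))
  sum-↑ {suc m} t = trans (cong (_+_ (t zero)) (sum-↑ {m} (t ∘ suc))) (sym (+-assoc (t zero) _ _))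

  sum-blow-up : ∀ a {n} (g : Fin n → ℤ) → sum (g ∘ remainder {a} n) ≡ + a * sum g
  sum-blow-up zero    g = sym (*-zeroˡ (sum g))
  sum-blow-up (suc a) {n} g = begin
    sum (g ∘ remainder {suc a} n)
      ≡⟨ sum-↑ {n} (g ∘ remainder {suc a} n) ⟩
    sum (g ∘ remainder {suc a} n ∘ (_↑ˡ (a ℕ.* n))) + sum (g ∘ remainder {suc a} n ∘ (n ↑ʳ_))
      ≡⟨ cong₂ _+_ (sum-cong-≗ (λ i → cong g (left i))) (trans (sum-cong-≗ (λ i → cong g (right i))) (sum-blow-up a g)) ⟩
    sum g + + a * sum g
      ≡⟨ suc-* (+ a) (sum g) ⟨
    + suc a * sum g ∎
    where
    open ≡-Reasoning
    left : ∀ i → remainder {suc a} n (i ↑ˡ (a ℕ.* n)) ≡ i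
    left i rewrite Fin.splitAt-↑ˡ n i (a ℕ.* n) = refl
    right : ∀ i → remainder {suc a} n (n ↑ʳ i) ≡ remainder {a} n i
    right i rewrite Fin.splitAt-↑ʳ n (a ℕ.* n) i = refl

  -- Copying every vertex `a` times multiplies the form by a² and keeps densities. With y = Y/δ, W =
  -- 8δ and s = jn, the bound yN² is 4s²Z.
  blow-up-≥ : ∀ {j n δ Y Q Z a X} → 0ℤ ≤ δ → n * n * Y ≤ δ * Q →
    Z ≡ + 64 * Y * δ → a ≡ + 2 * (+ 8 * δ) * j → X ≡ a * (a * Q) → + 4 * (j * n * (j * n)) * Z ≤ X
  blow-up-≥ {j} {n} {δ} {Y} {Q} 0≤δ nnY≤δQ refl refl refl =
    ≤-by (0≤* (0≤* (0≤+n {256}) (0≤* (0≤² j) 0≤δ)) (gap nnY≤δQ)) (lemma j n δ Y Q)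
    where
    lemma : ∀ j n δ Y Q → + 256 * (j * j * δ) * (δ * Q - n * n * Y) ≡
      + 2 * (+ 8 * δ) * j * (+ 2 * (+ 8 * δ) * j * Q) - + 4 * (j * n * (j * n)) * (+ 64 * Y * δ)
    lemma = solve-∀

  module BlowUp {n : ℕ} (1≤n : 1ℤ ≤ + n) (G : Colour → Graph n)
    (no-rainbow : ∀ u v w → Adj (G 0F) u v → Adj (G 1F) v w → Adj (G 2F) w u → ⊥)
    (A : ℤ) (A≤ : ∀ k → A ≤ + 81 * + ∣E G k ∣ - + 26 * (+ n * + n))
    (A² : A * A < + 28 * (+ n * + n * (+ n * + n))) where

    open FromGraphs G no-rainbow

    -- Here y = Y/δ: in Q_k colour k cancels, and two edge counts of at least (26n² + A)/81 give (4A
    -- + (4·26 - 81)n²)/(81n²). Then W = 8δ is the denominator of θ = (9y + 1)/8, and `j` makes s ≥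
    -- 1000W⁵.
    ν δ Y W R Θ j s : ℤ
    ν = + n * + n
    δ = + 81 * ν
    Y = + 4 * A + + 23 * ν
    W = + 8 * δ
    Θ = + 9 * Y + δ
    R = + 64 * Y * δ - Θ * Θ
    j = + 1000 * (W * W * (W * W) * W)
    s = j * + n

    1≤ν : 1ℤ ≤ ν
    1≤ν = 1≤* 1≤n 1≤n

    1≤δ : 1ℤ ≤ δ
    1≤δ = 1≤* {+ 81} (+≤+ (ℕ.s≤s ℕ.z≤n)) 1≤ν

    1≤W : 1ℤ ≤ W
    1≤W = 1≤* {+ 8} (+≤+ (ℕ.s≤s ℕ.z≤n)) 1≤δ

    1≤W⁵ : 1ℤ ≤ W * W * (W * W) * W
    1≤W⁵ = 1≤* (1≤* (1≤* 1≤W 1≤W) (1≤* 1≤W 1≤W)) 1≤W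

    1≤j : 1ℤ ≤ j
    1≤j = 1≤* {+ 1000} (+≤+ (ℕ.s≤s ℕ.z≤n)) 1≤W⁵

    -- This is where √7 enters: θ² < y means 81y² - 46y + 1 < 0, with roots (23 ± 8√7)/81, the
    -- smaller being τ². In terms of `A` the roots are ±2√7n².
    R-eq : R ≡ + 81 * (+ 16 * (+ 28 * (ν * ν) - A * A))
    R-eq = trans (expand (+ 81) Y ν) (trans (factor (+ 81) (+ 46 * Y * ν - + 81 * (ν * ν)) (Y * Y))
      (cong (_*_ (+ 81)) (in-A A ν)))
      where
      expand : ∀ c Y ν → + 64 * Y * (c * ν) - (+ 9 * Y + c * ν) * (+ 9 * Y + c * ν) ≡
                         c * (+ 46 * Y * ν - c * (ν * ν)) - + 81 * (Y * Y)
      expand = solve-∀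
      factor : ∀ c x y → c * x - c * y ≡ c * (x - y)
      factor = solve-∀
      in-A : ∀ A ν → + 46 * (+ 4 * A + + 23 * ν) * ν - + 81 * (ν * ν) - (+ 4 * A + + 23 * ν) * (+ 4 * A + + 23 * ν) ≡
                     + 16 * (+ 28 * (ν * ν) - A * A)
      in-A = solve-∀

    1≤R : 1ℤ ≤ R
    1≤R = subst (1ℤ ≤_) (sym R-eq) (1≤* {+ 81} (+≤+ (ℕ.s≤s ℕ.z≤n)) (1≤* {+ 16} (+≤+ (ℕ.s≤s ℕ.z≤n)) (≤-by (gap-< A²) refl)))

    -- 23² > 16 · 28
    0≤Y : 0ℤ ≤ Y
    0≤Y = by-cases (0ℤ ≤? Y)
      where
      lemma : ∀ A ν → + 16 * (+ 28 * (ν * ν) - A * A - 1ℤ)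
        + ((- 1ℤ - (+ 4 * A + + 23 * ν)) * (- 1ℤ - (+ 4 * A + + 23 * ν))
        + + 2 * (+ 23 * ν + 1ℤ) * (- 1ℤ - (+ 4 * A + + 23 * ν))
        + (+ 46 * ν + + 81 * (ν * ν))) ≡ - + 17
      lemma = solve-∀
      below-zero : Y < 0ℤ → 0ℤ ≤ - 1ℤ - Y
      below-zero Y<0 = subst (0ℤ ≤_) (regroup Y) (gap-< Y<0)
        where
        regroup : ∀ y → 0ℤ - y - 1ℤ ≡ - 1ℤ - y
        regroup = solve-∀
      by-cases : Dec (0ℤ ≤ Y) → 0ℤ ≤ Y
      by-cases (yes p) = p
      by-cases (no ¬p) = let q = below-zero (≰⇒> ¬p) in neg-absurd
        (0≤+ (0≤* (0≤+n {16}) (gap-< A²)) (0≤+ (0≤+ (0≤* q q)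
          (0≤* (0≤* (0≤+n {2}) (0≤+ (0≤* (0≤+n {23}) (0≤≥1 1≤ν)) (0≤+n {1}))) q))
          (0≤+ (0≤* (0≤+n {46}) (0≤≥1 1≤ν)) (0≤* (0≤+n {81}) (0≤² ν)))))
        (lemma A ν)

    1≤Θ : 1ℤ ≤ Θ
    1≤Θ = ≤-by (0≤+ (0≤* (0≤+n {9}) 0≤Y) (gap 1≤δ)) (lemma (+ 9 * Y) δ)
      where
      lemma : ∀ a b → a + (b - 1ℤ) ≡ a + b - 1ℤ
      lemma = solve-∀

    Z-eq : R + Θ * Θ ≡ + 64 * Y * δ
    Z-eq = lemma (+ 64 * Y * δ) (Θ * Θ)
      where
      lemma : ∀ a b → a - b + b ≡ a
      lemma = solve-∀

    θ-eq : + 9 * (R + Θ * Θ) + W * W ≡ + 8 * Θ * W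
    θ-eq = trans (cong (λ z → + 9 * z + W * W) Z-eq) (lemma Y δ)
      where
      lemma : ∀ Y δ → + 9 * (+ 64 * Y * δ) + + 8 * δ * (+ 8 * δ) ≡ + 8 * (+ 9 * Y + δ) * (+ 8 * δ)
      lemma = solve-∀

    q : Colour → Fin n → Fin n → ℤ
    q k u v = qval k (cell u v)

    e : Colour → ℤ
    e k = + ∣E G k ∣

    base-form : ∀ k → sum (λ u → sum (q k u)) ≡ + 2 * e 0F + + 2 * e 1F + + 2 * e 2F - + n * (+ n * 1ℤ) - + 2 * e k
    base-form k = begin
      sum (λ u → sum (q k u))
        ≡⟨ ∑∑-cong (λ u v → trans (qval-indicators k (cell u v))
             (cong₂ _-_ (cong (_- 1ℤ) (cong₂ _+_ (cong₂ _+_ (ind u v 0F) (ind u v 1F)) (ind u v 2F))) (ind u v k))) ⟩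
      sum (λ u → sum (λ v → i 0F u v + i 1F u v + i 2F u v - 1ℤ - i k u v))
        ≡⟨ trans (∑∑-- (λ u v → i 0F u v + i 1F u v + i 2F u v - 1ℤ) (i k))
           (cong (_- sum (λ u → sum (i k u))) (trans (∑∑-- (λ u v → i 0F u v + i 1F u v + i 2F u v) (λ _ _ → 1ℤ))
           (cong₂ _-_ (trans (∑∑-+ (λ u v → i 0F u v + i 1F u v) (i 2F)) (cong (_+ sum (λ u → sum (i 2F u))) (∑∑-+ (i 0F) (i 1F))))
             (trans (sum-cong-≗ {n} (λ _ → sum-const n 1ℤ)) (sum-const n (+ n * 1ℤ)))))) ⟩
      sum (λ u → sum (i 0F u)) + sum (λ u → sum (i 1F u)) + sum (λ u → sum (i 2F u)) - + n * (+ n * 1ℤ) - sum (λ u → sum (i k u))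
        ≡⟨ cong₂ (λ x y → x - + n * (+ n * 1ℤ) - y)
             (cong₂ _+_ (cong₂ _+_ (double-count (G 0F)) (double-count (G 1F))) (double-count (G 2F)))
             (double-count (G k)) ⟩
      + 2 * e 0F + + 2 * e 1F + + 2 * e 2F - + n * (+ n * 1ℤ) - + 2 * e k ∎
      where
      open ≡-Reasoning
      i : Colour → Fin n → Fin n → ℤ
      i k u v = indicator (adj k u v)
      ind : ∀ u v k → indicator (has (cell u v) k) ≡ i k u v
      ind u v k = cong indicator (has-cell u v k)
      ∑∑-cong : ∀ {t t′ : Fin n → Fin n → ℤ} → (∀ u v → t u v ≡ t′ u v) → sum (λ u → sum (t u)) ≡ sum (λ u → sum (t′ u))
      ∑∑-cong t≡ = sum-cong-≗ (λ u → sum-cong-≗ (t≡ u))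
      ∑∑-+ : ∀ (t t′ : Fin n → Fin n → ℤ) → sum (λ u → sum (λ v → t u v + t′ u v)) ≡ sum (λ u → sum (t u)) + sum (λ u → sum (t′ u))
      ∑∑-+ t t′ = trans (sum-cong-≗ (λ u → ∑-distrib-+ (t u) (t′ u))) (∑-distrib-+ (λ u → sum (t u)) (λ u → sum (t′ u)))
      ∑∑-- : ∀ (t t′ : Fin n → Fin n → ℤ) → sum (λ u → sum (λ v → t u v - t′ u v)) ≡ sum (λ u → sum (t u)) - sum (λ u → sum (t′ u))
      ∑∑-- t t′ = trans (sum-cong-≗ (λ u → ∑-distrib-- (t u) (t′ u))) (∑-distrib-- (λ u → sum (t u)) (λ u → sum (t′ u)))

    Y≤ : ∀ k → Y ≤ + 81 * sum (λ u → sum (q k u))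
    Y≤ k = subst (λ x → Y ≤ + 81 * x) (sym (base-form k)) (from-two k)
      where
      form : Colour → ℤ
      form k = + 2 * e 0F + + 2 * e 1F + + 2 * e 2F - + n * (+ n * 1ℤ) - + 2 * e k
      others : ∀ {k l m} → form k ≡ + 2 * e l + + 2 * e m - ν → Y ≤ + 81 * form k
      others {k} {l} {m} eq = subst (λ x → Y ≤ + 81 * x) (sym eq) (≤-by
        (0≤+ (0≤* (0≤+n {2}) (gap (A≤ l))) (0≤* (0≤+n {2}) (gap (A≤ m)))) (lemma A ν (e l) (e m)))
        where
        lemma : ∀ A ν x y → + 2 * (+ 81 * x - + 26 * ν - A) + + 2 * (+ 81 * y - + 26 * ν - A) ≡
                            + 81 * (+ 2 * x + + 2 * y - ν) - (+ 4 * A + + 23 * ν)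
        lemma = solve-∀
      from-two : ∀ k → Y ≤ + 81 * form k
      from-two 0F = others {0F} {1F} {2F} (lemma (e 0F) (e 1F) (e 2F) (+ n))
        where
        lemma : ∀ a b c n → + 2 * a + + 2 * b + + 2 * c - n * (n * 1ℤ) - + 2 * a ≡ + 2 * b + + 2 * c - n * n
        lemma = solve-∀
      from-two 1F = others {1F} {0F} {2F} (lemma (e 0F) (e 1F) (e 2F) (+ n))
        where
        lemma : ∀ a b c n → + 2 * a + + 2 * b + + 2 * c - n * (n * 1ℤ) - + 2 * b ≡ + 2 * a + + 2 * c - n * n
        lemma = solve-∀
      from-two 2F = others {2F} {0F} {1F} (lemma (e 0F) (e 1F) (e 2F) (+ n))
        where
        lemma : ∀ a b c n → + 2 * a + + 2 * b + + 2 * c - n * (n * 1ℤ) - + 2 * c ≡ + 2 * a + + 2 * b - n * n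
        lemma = solve-∀

    νY≤δQ : ∀ k → ν * Y ≤ δ * sum (λ u → sum (q k u))
    νY≤δQ k = ≤-by (0≤* (0≤≥1 1≤ν) (gap (Y≤ k))) (lemma (+ 81) ν Y (sum (λ u → sum (q k u))))
      where
      lemma : ∀ c ν Y Q → ν * (c * Q - Y) ≡ c * ν * Q - ν * Y
      lemma = solve-∀

    absurd : ∀ a → + a ≡ + 2 * W * j → ⊥
    absurd a a≡ = no-dense-template template scale (remainder {a} n) dense
      where
      scale : Scale (a ℕ.* n)
      scale = record
        { W = W ; Θ = Θ ; R = R ; s = s ; 1≤W = 1≤W ; 1≤Θ = 1≤Θ ; 1≤R = 1≤R ; 1≤s = 1≤* 1≤j 1≤n
        ; N≡2Ws = trans (pos-* a n) (trans (cong (_* + n) a≡) (*-assoc (+ 2 * W) j (+ n)))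
        ; s-large = ≤-by (0≤* (0≤≥1 1≤j) (gap 1≤n)) (factor j (+ n))
        ; θ-eq = θ-eq }
        where
        factor : ∀ j n → j * (n - 1ℤ) ≡ j * n - j
        factor = solve-∀
      quad-blow-up : ∀ k → sum (λ x → sum (λ y → q k (remainder {a} n x) (remainder {a} n y))) ≡
                           + a * (+ a * sum (λ u → sum (q k u)))
      quad-blow-up k = trans (sum-cong-≗ (λ x → sum-blow-up a (q k (remainder {a} n x))))
        (trans (sum-blow-up a (λ u → + a * sum (q k u)))
               (cong (_*_ (+ a)) (sym (*-distribˡ-sum (+ a) (λ u → sum (q k u))))))
      dense : ∀ k → + 4 * (s * s) * (R + Θ * Θ) ≤ Penalised.Q.quad template scale k (remainder {a} n)
      dense k = blow-up-≥ {j} {+ n} {δ} {Y} {sum (λ u → sum (q k u))} {R + Θ * Θ} {+ a}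
        (0≤≥1 1≤δ) (νY≤δQ k) Z-eq a≡ (quad-blow-up k)

  Dense : ∀ {n} → Graph n → Set
  Dense {n} G = let A = + 81 * + ∣E G ∣ - + 26 * (+ n * + n) in
                0ℤ < A ⊎ A * A < + 28 * (+ n * + n * (+ n * + n))

  no-dense-graphs : ∀ {n} (G : Colour → Graph n) →
    (∀ u v w → Adj (G 0F) u v → Adj (G 1F) v w → Adj (G 2F) w u → ⊥) → 1ℤ ≤ + n →
    ¬ (∀ k → Dense (G k))
  no-dense-graphs {n} G no-rainbow 1≤n dense =
    M.absurd ∣ + 2 * M.W * M.j ∣ (0≤i⇒+∣i∣≡i (0≤* (0≤* (0≤+n {2}) (0≤≥1 M.1≤W)) (0≤≥1 M.1≤j)))
    where
    bound = + 28 * (+ n * + n * (+ n * + n))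
    excess : Colour → ℤ
    excess k = + 81 * + ∣E G k ∣ - + 26 * (+ n * + n)
    -- A very dense graph could push y beyond the larger root, where θ² < y fails; lowering the
    -- bound to 0 keeps it valid and between the roots.
    capped : Colour → ℤ
    capped k = excess k ⊓ 0ℤ
    Small : ℤ → Set
    Small x = x * x < bound
    small-⊓ : ∀ x y → Small x → Small y → Small (x ⊓ y)
    small-⊓ x y p q = [ (λ eq → subst Small (sym eq) p) , (λ eq → subst Small (sym eq) q) ]′ (⊓-sel x y)
    0<bound : 0ℤ < bound
    0<bound = suc[i]≤j⇒i<j (1≤* {+ 28} (+≤+ (ℕ.s≤s ℕ.z≤n)) (1≤* (1≤* 1≤n 1≤n) (1≤* 1≤n 1≤n)))
    small-capped : ∀ k → Small (capped k)
    small-capped k = [ (λ 0<A → subst Small (sym (i≥j⇒i⊓j≡j (<⇒≤ 0<A))) 0<bound) , (λ A²< → small-⊓ (excess k) 0ℤ A²< 0<bound) ]′ (dense k)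
    A = capped 0F ⊓ capped 1F ⊓ capped 2F
    A≤ : ∀ k → A ≤ excess k
    A≤ 0F = ≤-trans (i⊓j≤i (capped 0F ⊓ capped 1F) (capped 2F)) (≤-trans (i⊓j≤i (capped 0F) (capped 1F)) (i⊓j≤i (excess 0F) 0ℤ))
    A≤ 1F = ≤-trans (i⊓j≤i (capped 0F ⊓ capped 1F) (capped 2F)) (≤-trans (i⊓j≤j (capped 0F) (capped 1F)) (i⊓j≤i (excess 1F) 0ℤ))
    A≤ 2F = ≤-trans (i⊓j≤j (capped 0F ⊓ capped 1F) (capped 2F)) (i⊓j≤i (excess 2F) 0ℤ)
    module M = BlowUp 1≤n G no-rainbow A A≤ (small-⊓ (capped 0F ⊓ capped 1F) (capped 2F)
      (small-⊓ (capped 0F) (capped 1F) (small-capped 0F) (small-capped 1F)) (small-capped 2F))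

-- From the order on ℚ(√7) to integer inequalities.

module Threshold where

  open import Data.Integer.Base as ℤ using (ℤ; +_; 0ℤ)
  import Data.Integer.Properties as ℤ
  open import Data.Integer.Tactic.RingSolver using (solve-∀)
  open import Data.Rational.Base
  open import Data.Rational.Properties
  open import Data.Rational.Solver using (module +-*-Solver)
  open import Data.Rational.Unnormalised.Base as ℚᵘ using (mkℚᵘ; *<*; *≡*)
  import Data.Rational.Unnormalised.Properties as ℚᵘ
  open import Defs using (τ; fromℕ; _+√7·_)
  import Defs as D

  ι : ℤ → ℚ
  ι z = z / 1

  toℚᵘ-ι : ∀ z → toℚᵘ (ι z) ℚᵘ.≃ mkℚᵘ z 0
  toℚᵘ-ι z = toℚᵘ-fromℚᵘ (mkℚᵘ z 0)

  ι-cancel-< : ∀ {x y} → ι x < ι y → x ℤ.< y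
  ι-cancel-< {x} {y} p with ℚᵘ.<-respˡ-≃ (toℚᵘ-ι x) (ℚᵘ.<-respʳ-≃ (toℚᵘ-ι y) (toℚᵘ-mono-< p))
  ... | *<* q = subst₂ ℤ._<_ (ℤ.*-identityʳ x) (ℤ.*-identityʳ y) q

  ι-* : ∀ x y → ι x * ι y ≡ ι (x ℤ.* y)
  ι-* x y = toℚᵘ-injective (ℚᵘ.≃-trans (toℚᵘ-homo-* (ι x) (ι y))
    (ℚᵘ.≃-trans (ℚᵘ.*-cong (toℚᵘ-ι x) (toℚᵘ-ι y)) (ℚᵘ.≃-trans (*≡* refl) (ℚᵘ.≃-sym (toℚᵘ-ι (x ℤ.* y))))))

  ι-+ : ∀ x y → ι x + ι y ≡ ι (x ℤ.+ y)
  ι-+ x y = toℚᵘ-injective (ℚᵘ.≃-trans (toℚᵘ-homo-+ (ι x) (ι y))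
    (ℚᵘ.≃-trans (ℚᵘ.+-cong (toℚᵘ-ι x) (toℚᵘ-ι y)) (ℚᵘ.≃-trans (*≡* (lemma x y)) (ℚᵘ.≃-sym (toℚᵘ-ι (x ℤ.+ y))))))
    where
    lemma : ∀ x y → (x ℤ.* + 1 ℤ.+ y ℤ.* + 1) ℤ.* + 1 ≡ (x ℤ.+ y) ℤ.* + 1
    lemma = solve-∀

  ι-neg : ∀ x → - ι x ≡ ι (ℤ.- x)
  ι-neg x = toℚᵘ-injective (ℚᵘ.≃-trans (toℚᵘ-homo‿- (ι x))
    (ℚᵘ.≃-trans (ℚᵘ.-‿cong (toℚᵘ-ι x)) (ℚᵘ.≃-trans (*≡* refl) (ℚᵘ.≃-sym (toℚᵘ-ι (ℤ.- x))))))

  open +-*-Solver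

  -- Clears away the zero irrational parts of embedded rationals. The coefficients stay variables;
  -- that (1 + τ²)/4 has coefficients 26/81 and -2/81 is left to conversion in `above-threshold`.
  positive-expand : ∀ e m x y →
    D.Positive ((e +√7· 0ℚ) D.- ((x +√7· y) D.* ((m +√7· 0ℚ) D.* (m +√7· 0ℚ)))) →
    D.Positive ((e - x * (m * m)) +√7· (- (y * (m * m))))
  positive-expand e m x y = subst₂ (λ a b → D.Positive (a +√7· b)) (rat e m x y) (irr m x y)
    where
    rat : ∀ e m x y → e - (x * (m * m + (+ 7 / 1) * (0ℚ * 0ℚ)) + (+ 7 / 1) * (y * (m * 0ℚ + 0ℚ * m))) ≡ e - x * (m * m)
    rat = solve 4 (λ e m x y →
      e :- (x :* (m :* m :+ con (+ 7 / 1) :* (con 0ℚ :* con 0ℚ)) :+ con (+ 7 / 1) :* (y :* (m :* con 0ℚ :+ con 0ℚ :* m)))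
      := e :- x :* (m :* m)) refl
    irr : ∀ m x y → 0ℚ - (x * (m * 0ℚ + 0ℚ * m) + y * (m * m + (+ 7 / 1) * (0ℚ * 0ℚ))) ≡ - (y * (m * m))
    irr = solve 3 (λ m x y →
      con 0ℚ :- (x :* (m :* con 0ℚ :+ con 0ℚ :* m) :+ y :* (m :* m :+ con (+ 7 / 1) :* (con 0ℚ :* con 0ℚ)))
      := :- (y :* (m :* m))) refl

  -- e > (26 − 2√7)n²/81 says that A = 81e − 26n² exceeds −2√7 n², whose square is 28n⁴.
  above-threshold : ∀ e n → fromℕ e D.> ((fromℕ 1 D.+ τ D.* τ) D.÷ 4) D.* (fromℕ n D.* fromℕ n) →
    let A = + 81 ℤ.* + e ℤ.- + 26 ℤ.* (+ n ℤ.* + n) in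
    0ℤ ℤ.< A ⊎ A ℤ.* A ℤ.< + 28 ℤ.* (+ n ℤ.* + n ℤ.* (+ n ℤ.* + n))
  above-threshold e n e> = conclude (subst₂ (λ a b → D.Positive (a +√7· b)) (scale-A (ι (+ e)) (ι (+ n)))
      (scale-B (ι (+ n))) (positive-expand (ι (+ e)) (ι (+ n)) (+ 26 / 81) (- (+ 2 / 81)) e>))
    where
    c = + 1 / 81
    ν = + n ℤ.* + n
    A = + 81 ℤ.* + e ℤ.- + 26 ℤ.* ν
    a = ι (+ 81) * ι (+ e) - ι (+ 26) * (ι (+ n) * ι (+ n))
    scale-A : ∀ e m → e - (+ 26 / 81) * (m * m) ≡ c * (ι (+ 81) * e - ι (+ 26) * (m * m))
    scale-A = solve 2 (λ e m → e :- con (+ 26 / 81) :* (m :* m) :=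
      con (+ 1 / 81) :* (con (ι (+ 81)) :* e :- con (ι (+ 26)) :* (m :* m))) refl
    scale-B : ∀ m → - ((- (+ 2 / 81)) * (m * m)) ≡ c * (ι (+ 2) * (m * m))
    scale-B = solve 1 (λ m → :- (con (- (+ 2 / 81)) :* (m :* m)) := con (+ 1 / 81) :* (con (ι (+ 2)) :* (m :* m))) refl
    a≡ιA : a ≡ ι A
    a≡ιA = trans (cong₂ (λ x y → x - ι (+ 26) * y) (ι-* (+ 81) (+ e)) (ι-* (+ n) (+ n)))
      (trans (cong (_+_ (ι (+ 81 ℤ.* + e))) (trans (cong -_ (ι-* (+ 26) ν)) (ι-neg (+ 26 ℤ.* ν)))) (ι-+ (+ 81 ℤ.* + e) (ℤ.- (+ 26 ℤ.* ν))))
    square : ∀ x → c * x * (c * x) ≡ c * c * (x * x)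
    square = solve 1 (λ x → con (+ 1 / 81) :* x :* (con (+ 1 / 81) :* x) := con (+ 1 / 81) :* con (+ 1 / 81) :* (x :* x)) refl
    square-B : ∀ m → (+ 7 / 1) * (c * (ι (+ 2) * (m * m)) * (c * (ι (+ 2) * (m * m)))) ≡ c * c * (ι (+ 28) * (m * m * (m * m)))
    square-B = solve 1 (λ m → con (+ 7 / 1) :* (con (+ 1 / 81) :* (con (ι (+ 2)) :* (m :* m)) :* (con (+ 1 / 81) :* (con (ι (+ 2)) :* (m :* m))))
      := con (+ 1 / 81) :* con (+ 1 / 81) :* (con (ι (+ 28)) :* (m :* m :* (m :* m)))) refl
    conclude : D.Positive ((c * a) +√7· (c * (ι (+ 2) * (ι (+ n) * ι (+ n))))) →
               0ℤ ℤ.< A ⊎ A ℤ.* A ℤ.< + 28 ℤ.* (ν ℤ.* ν)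
    conclude (inj₁ (0<ca , _)) = inj₁ (ι-cancel-< (subst (0ℚ <_) a≡ιA
      (*-cancelˡ-<-nonNeg c (subst (_< c * a) (sym (*-zeroʳ c)) 0<ca))))
    conclude (inj₂ (_ , aa<)) = inj₂ (ι-cancel-< (subst₂ _<_
      (trans (cong₂ _*_ a≡ιA a≡ιA) (ι-* A A))
      (trans (cong (ι (+ 28) *_) (trans (cong₂ _*_ (ι-* (+ n) (+ n)) (ι-* (+ n) (+ n))) (ι-* ν ν))) (ι-* (+ 28) (ν ℤ.* ν)))
      (*-cancelˡ-<-nonNeg (c * c) (subst₂ _<_ (square a) (square-B (ι (+ n))) aa<))))

-- Decidable search turns the contradiction into a triangle.

open import Data.Integer.Base using (+≤+; +<+)
open Counting using (choose; Dense; no-dense-graphs)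
open Threshold using (above-threshold)
open import Defs

theorem1p2 : ((fromℕ 1 + τ * τ) ÷ 4 ≡ (fromℕ 26 - fromℕ 2 * √7) ÷ 81)
    × (∀ (n : ℕ) (G₁ G₂ G₃ : Graph n) →
    fromℕ ∣E G₁ ∣ > (fromℕ 1 + τ * τ) ÷ 4 * (fromℕ n * fromℕ n) →
    fromℕ ∣E G₂ ∣ > (fromℕ 1 + τ * τ) ÷ 4 * (fromℕ n * fromℕ n) →
    fromℕ ∣E G₃ ∣ > (fromℕ 1 + τ * τ) ÷ 4 * (fromℕ n * fromℕ n) →
    ∃[ v₁ ] ∃[ v₂ ] ∃[ v₃ ]
    (v₁ ≢ v₂ × v₂ ≢ v₃ × v₃ ≢ v₁
    × Adj G₁ v₁ v₂ × Adj G₂ v₂ v₃ × Adj G₃ v₃ v₁))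
theorem1p2 = refl , rainbow-triangle
  where
  rainbow-triangle : ∀ n (G₁ G₂ G₃ : Graph n) →
    fromℕ ∣E G₁ ∣ > (fromℕ 1 + τ * τ) ÷ 4 * (fromℕ n * fromℕ n) →
    fromℕ ∣E G₂ ∣ > (fromℕ 1 + τ * τ) ÷ 4 * (fromℕ n * fromℕ n) →
    fromℕ ∣E G₃ ∣ > (fromℕ 1 + τ * τ) ÷ 4 * (fromℕ n * fromℕ n) →
    ∃[ v₁ ] ∃[ v₂ ] ∃[ v₃ ]
    (v₁ ≢ v₂ × v₂ ≢ v₃ × v₃ ≢ v₁ × Adj G₁ v₁ v₂ × Adj G₂ v₂ v₃ × Adj G₃ v₃ v₁)
  -- Without vertices the edge count and the bound are both 0, so the strict hypothesis fails.
  rainbow-triangle zero _ _ _ e₁ _ _ = [ (λ { (+<+ ()) }) , (λ { (+<+ ()) }) ]′ (above-threshold 0 0 e₁)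
  rainbow-triangle n@(suc _) G₁ G₂ G₃ e₁ e₂ e₃ =
    search (any? λ u → any? λ v → any? λ w → Graph.adj? G₁ u v ×-dec Graph.adj? G₂ v w ×-dec Graph.adj? G₃ w u)
    where
    G = choose G₁ G₂ G₃
    dense : ∀ k → Dense (G k)
    dense 0F = above-threshold ∣E G₁ ∣ n e₁
    dense 1F = above-threshold ∣E G₂ ∣ n e₂
    dense 2F = above-threshold ∣E G₃ ∣ n e₃
    loopless : ∀ (H : Graph n) {u v} → Adj H u v → u ≢ v
    loopless H uv u≡v = Graph.irrefl H u≡v uv
    search : Dec (∃[ u ] ∃[ v ] ∃[ w ] Adj G₁ u v × Adj G₂ v w × Adj G₃ w u) →
             ∃[ u ] ∃[ v ] ∃[ w ] (u ≢ v × v ≢ w × w ≢ u × Adj G₁ u v × Adj G₂ v w × Adj G₃ w u)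
    search (yes (u , v , w , uv , vw , wu)) =
      u , v , w , loopless G₁ uv , loopless G₂ vw , loopless G₃ wu , uv , vw , wu
    search (no ∄) = ⊥-elim (no-dense-graphs G (λ u v w uv vw wu → ∄ (u , v , w , uv , vw , wu))
      (+≤+ (ℕ.s≤s ℕ.z≤n)) dense)
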